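{- For any $\varepsilon>0$ and any monotone summable property $\mathcal{P}$ of a proper minor-closed class $\mathcal{G}$, there are constants $r\ge 0$ and $K\ge 0$ such that $\mathcal{P}$ has an $r$-round $\varepsilon$-approximate proof labelling scheme of complexity at most $K$.
   Context: All graphs are finite and simple. A class of graphs is minor-closed if every minor of a graph in the class is in the class; it is proper if it does not contain all graphs. A property $\mathcal{P}$ of a class $\mathcal{G}$ is an isomorphism-closed class of graphs $\mathcal{P}\subseteq\mathcal{G}$; it is monotone if it is closed under taking (not necessarily induced) subgraphs, and summable if the disjoint union of any two graphs in $\mathcal{P}$ is also in $\mathcal{P}$. A graph $G$ is $\varepsilon$-far from $\mathcal{P}$ if $G\notin\mathcal{P}$ and one needs to modify at least $\varepsilon|E(G)|$ adjacencies of $G$ (replacing edges by non-edges and vice versa, on the vertex set of $G$) in order to obtain a graph in $\mathcal{P}$ (this graph need not be connected). Local certification. The instance graphs $G$ to be certified are connected, and the vertices of an $n$-vertex instance are assigned distinct but otherwise arbitrary identifiers from $\{1,\dots,\mathrm{poly}(n)\}$ (for some fixed polynomial); instances are considered as labelled by these identifiers, and so are their subgraphs. A proof for $G$ is a function $P:V(G)\to\{0,1\}^*$ (it may depend on the identifiers); its size is the maximum length of a certificate $P(v)$, $v\in V(G)$. A verifier $\mathcal{A}$ is a function taking a (labelled) graph $G$, a proof $P$ for $G$ and a vertex $v\in V(G)$ and returning an element of $\{0,1\}$. Let $B_r(v)$ be the set of vertices at distance at most $r$ from $v$ in $G$, let $G[v,r]$ be the subgraph of $G$ induced by $B_r(v)$,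 and let $P[v,r]$ be the restriction of $P$ to $B_r(v)$. The verifier $\mathcal{A}$ is local with local horizon at most $r$ if $\mathcal{A}(G,P,v)=\mathcal{A}(G[v,r],P[v,r],v)$ for all $G,P,v$. An $r$-round $\varepsilon$-approximate proof labelling scheme for $\mathcal{P}$ is a pair consisting of a prover, which maps each instance $G\in\mathcal{P}$ to a proof $P_G$ for $G$, and a local verifier $\mathcal{A}$ with local horizon at most $r$, such that: (completeness) if $G\in\mathcal{P}$, then $\mathcal{A}(G,P_G,v)=1$ for every $v\in V(G)$; (soundness) if $G$ is $\varepsilon$-far from $\mathcal{P}$, then for every proof $P'$ for $G$ there is a vertex $v\in V(G)$ with $\mathcal{A}(G,P',v)=0$. The complexity of the scheme is the maximum size of the proof $P_G$ over $n$-vertex instances $G\in\mathcal{P}$ (as a function of $n$); complexity at most $K$ means this is at most $K$ for all $n$. -}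

module Defs where

open import Level using (0ℓ)
open import Data.Bool.Base using (Bool; true; false; T; _∧_; _xor_)
open import Data.Nat.Base as ℕ using (ℕ; suc; _≤_; _<ᵇ_; _⊔_)
open import Data.Integer.Base using (+_)
open import Data.Rational.Base as ℚ using (ℚ; 0ℚ)
open import Data.Fin.Base using (Fin; toℕ; splitAt)
open import Data.Fin.Subset using (Subset; _∈_; ⊤; Nonempty)
open import Data.List.Base as List using (List; length; filterᵇ; cartesianProduct; allFin)
open import Data.Product.Base using (Σ-syntax; ∃-syntax; _×_; _,_)
open import Data.Sum.Base using (_⊎_; inj₁; inj₂)
open import Data.Vec.Functional as VF using (Vector)
open import Function.Base using (_∘_)
open import Function.Bundles using (_⇔_; _↔_; Inverse)
open import Function.Definitions using (Injective)
open import Relation.Binary.Construct.Closure.ReflexiveTransitive using (Star)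
open import Relation.Binary.PropositionalEquality using (_≡_; refl)
open import Relation.Nullary.Negation using (¬_)
open import Relation.Unary using (Pred)

-- Two-sided Dedekind reals.

record ℝ : Set₁ where
  field
    Lower Upper     : Pred ℚ 0ℓ
    lower-inhabited : ∃[ q ] Lower q
    upper-inhabited : ∃[ q ] Upper q
    lower-rounded   : ∀ q → Lower q ⇔ (∃[ s ] q ℚ.< s × Lower s)
    upper-rounded   : ∀ q → Upper q ⇔ (∃[ s ] s ℚ.< q × Upper s)
    disjoint        : ∀ q → ¬ (Lower q × Upper q)
    located         : ∀ q s → q ℚ.< s → Lower q ⊎ Upper s

Positive : ℝ → Set
Positive x = ℝ.Lower x 0ℚ

ℕ⇒ℚ : ℕ → ℚ
ℕ⇒ℚ n = + n ℚ./ 1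

-- x · m ≤ k.  As m ≥ 0, the product x · m is the supremum of the q · m over
-- the rationals q < x.
_·_≤ᵣ_ : ℝ → ℕ → ℕ → Set
x · m ≤ᵣ k = ∀ q → ℝ.Lower x q → q ℚ.* ℕ⇒ℚ m ℚ.≤ ℕ⇒ℚ k

-- Coefficients, constant term first.
Polynomial : Set
Polynomial = List ℕ

eval : Polynomial → ℕ → ℕ
eval p x = List.foldr (λ a b → a ℕ.+ x ℕ.* b) 0 p

record Graph (n : ℕ) : Set where
  field
    adj        : Fin n → Fin n → Bool
    adj-sym    : ∀ u v → adj u v ≡ adj v u
    adj-irrefl : ∀ u → adj u u ≡ false

  _~_ : Fin n → Fin n → Set
  u ~ v = T (adj u v)

open Graph public using (adj)

private variable
  m n : ℕ

-- A vertex set is connected if it is nonempty and induces a connected subgraph;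
-- in particular the graph without vertices is not connected.
ConnectedOn : Graph n → Subset n → Set
ConnectedOn G S =
  Nonempty S ×
  (∀ {u v} → u ∈ S → v ∈ S → Star (λ x y → (x ~ y) × x ∈ S × y ∈ S) u v)
  where open Graph G

Connected : Graph n → Set
Connected G = ConnectedOn G ⊤

-- Within G r u v: there is a walk of length at most r from u to v, that is,
-- their distance is at most r.
data Within (G : Graph n) : ℕ → Fin n → Fin n → Set where
  here : ∀ {r u} → Within G r u u
  step : ∀ {r u v w} → Graph._~_ G u v → Within G r v w → Within G (suc r) u w

-- Number of unordered pairs of distinct vertices on which a symmetric f holds.
#pairs : (Fin n → Fin n → Bool) → ℕ
#pairs {n} f =
  length (filterᵇ (λ (u , v) → (toℕ u <ᵇ toℕ v) ∧ f u v)
                  (cartesianProduct (allFin n) (allFin n)))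

#edges : Graph n → ℕ
#edges G = #pairs (adj G)

#modifications : Graph n → Graph n → ℕ
#modifications G H = #pairs (λ u v → adj G u v xor adj H u v)

_≅_ : Graph m → Graph n → Set
_≅_ {m} {n} H G =
  Σ[ f ∈ (Fin m ↔ Fin n) ] (∀ x y → adj H x y ≡ adj G (Inverse.to f x) (Inverse.to f y))

-- H is isomorphic to a (not necessarily induced) subgraph of G.
_⊑_ : Graph m → Graph n → Set
_⊑_ {m} {n} H G =
  Σ[ f ∈ (Fin m → Fin n) ]
    Injective _≡_ _≡_ f × (∀ {x y} → Graph._~_ H x y → Graph._~_ G (f x) (f y))

-- H is a minor of G: the vertices of H are obtained by contracting disjoint
-- connected vertex sets (the branch sets) of a subgraph of G.
record _≼_ (H : Graph m) (G : Graph n) : Set where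
  field
    branch    : Fin m → Subset n
    connected : ∀ x → ConnectedOn G (branch x)
    disjoint  : ∀ {x y u} → u ∈ branch x → u ∈ branch y → x ≡ y
    edge      : ∀ {x y} → Graph._~_ H x y →
                ∃[ u ] ∃[ v ] u ∈ branch x × v ∈ branch y × Graph._~_ G u v

_⊎ᴳ_ : Graph m → Graph n → Graph (m ℕ.+ n)
_⊎ᴳ_ {m} {n} G H = record
  { adj        = λ u v → adj⊎ (splitAt m u) (splitAt m v)
  ; adj-sym    = λ u v → adj⊎-sym (splitAt m u) (splitAt m v)
  ; adj-irrefl = λ u → adj⊎-irrefl (splitAt m u)
  }
  where
  adj⊎ : Fin m ⊎ Fin n → Fin m ⊎ Fin n → Bool
  adj⊎ (inj₁ x) (inj₁ y) = adj G x y
  adj⊎ (inj₂ x) (inj₂ y) = adj H x y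
  adj⊎ (inj₁ _) (inj₂ _) = false
  adj⊎ (inj₂ _) (inj₁ _) = false

  adj⊎-sym : ∀ a b → adj⊎ a b ≡ adj⊎ b a
  adj⊎-sym (inj₁ x) (inj₁ y) = Graph.adj-sym G x y
  adj⊎-sym (inj₂ x) (inj₂ y) = Graph.adj-sym H x y
  adj⊎-sym (inj₁ _) (inj₂ _) = refl
  adj⊎-sym (inj₂ _) (inj₁ _) = refl

  adj⊎-irrefl : ∀ a → adj⊎ a a ≡ false
  adj⊎-irrefl (inj₁ x) = Graph.adj-irrefl G x
  adj⊎-irrefl (inj₂ x) = Graph.adj-irrefl H x

GraphClass : Set₁
GraphClass = ∀ {n} → Pred (Graph n) 0ℓ

-- This implies closure under isomorphism, since _≼_ disregards vertex names.
MinorClosed : GraphClass → Set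
MinorClosed 𝒢 = ∀ {m n} {H : Graph m} {G : Graph n} → H ≼ G → 𝒢 G → 𝒢 H

Proper : GraphClass → Set
Proper 𝒢 = ¬ (∀ {n} (G : Graph n) → 𝒢 G)

record IsPropertyOf (𝒫 𝒢 : GraphClass) : Set where
  field
    included   : ∀ {n} {G : Graph n} → 𝒫 G → 𝒢 G
    iso-closed : ∀ {m n} {H : Graph m} {G : Graph n} → H ≅ G → 𝒫 G → 𝒫 H

Monotone : GraphClass → Set
Monotone 𝒫 = ∀ {m n} {H : Graph m} {G : Graph n} → H ⊑ G → 𝒫 G → 𝒫 H

Summable : GraphClass → Set
Summable 𝒫 = ∀ {m n} {G : Graph m} {H : Graph n} → 𝒫 G → 𝒫 H → 𝒫 (G ⊎ᴳ H)

-- Vacuously, every graph is far from 𝒫 if no graph on its vertex set is in 𝒫.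
Far : ℝ → GraphClass → Graph n → Set
Far {n} ε 𝒫 G = ¬ 𝒫 G × (∀ (H : Graph n) → 𝒫 H → ε · #edges G ≤ᵣ #modifications G H)

record LabelledGraph (n : ℕ) : Set where
  field
    graph    : Graph n
    ident    : Fin n → ℕ
    distinct : Injective _≡_ _≡_ ident

open LabelledGraph public using (graph; ident)

record IsInstance (p : Polynomial) {n : ℕ} (G : LabelledGraph n) : Set where
  field
    connected : Connected (graph G)
    positive  : ∀ v → 1 ≤ ident G v
    bounded   : ∀ v → ident G v ≤ eval p n

Proof : ℕ → Set
Proof n = Vector (List Bool) n

size : Proof n → ℕ
size P = VF.foldr _⊔_ 0 (length ∘ P)

-- (H , Q , w) is (G[v,r] , P[v,r] , v).  The vertices of a labelled graph are
-- its identifiers and the indices in Fin n are only names for them, so the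
-- induced subgraph G[v,r] may be presented with any naming of its vertices.
record IsBall (r : ℕ) (G : LabelledGraph n) (P : Proof n) (v : Fin n)
                      (H : LabelledGraph m) (Q : Proof m) (w : Fin m) : Set where
  field
    embed     : Fin m → Fin n
    injective : Injective _≡_ _≡_ embed
    image     : ∀ u → Within (graph G) r v u ⇔ (∃[ x ] embed x ≡ u)
    induced   : ∀ x y → adj (graph H) x y ≡ adj (graph G) (embed x) (embed y)
    idents    : ∀ x → ident H x ≡ ident G (embed x)
    certs     : ∀ x → Q x ≡ P (embed x)
    centre    : embed w ≡ v

Verifier : Set
Verifier = ∀ {n} → LabelledGraph n → Proof n → Fin n → Bool

-- As this holds for all presentations of the ball, a local verifier does not
-- depend on the names in Fin n: it sees vertices only through identifiers.
Local : ℕ → Verifier → Set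
Local r A =
  ∀ {n m} (G : LabelledGraph n) (P : Proof n) (v : Fin n)
          (H : LabelledGraph m) (Q : Proof m) (w : Fin m) →
  IsBall r G P v H Q w → A G P v ≡ A H Q w

record ApproxProofLabellingScheme
  (p : Polynomial) (r : ℕ) (ε : ℝ) (𝒫 : GraphClass) : Set where
  field
    prover   : ∀ {n} (G : LabelledGraph n) → IsInstance p G → 𝒫 (graph G) → Proof n
    verifier : Verifier
    local    : Local r verifier
    complete : ∀ {n} (G : LabelledGraph n) (i : IsInstance p G) (G∈𝒫 : 𝒫 (graph G)) →
               ∀ v → verifier G (prover G i G∈𝒫) v ≡ true
    sound    : ∀ {n} (G : LabelledGraph n) → IsInstance p G → Far ε 𝒫 (graph G) →
               ∀ (P′ : Proof n) → ∃[ v ] verifier G P′ v ≡ false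

  ComplexityAtMost : ℕ → Set
  ComplexityAtMost K =
    ∀ {n} (G : LabelledGraph n) (i : IsInstance p G) (G∈𝒫 : 𝒫 (graph G)) →
    size (prover G i G∈𝒫) ≤ K

{-# OPTIONS --safe #-}

-- The graphs in 𝒫 exclude some minor on s vertices.  Following Klein, Plotkin and
-- Rao, such a graph is decomposed by s rounds of breadth-first layering; each round
-- groups the layers into blocks of k consecutive ones, starting at one of k offsets.
-- Over the k ^ s choices of offsets, every edge is cut in a fraction of at most s / k
-- of the choices.  The pieces have bounded weak diameter: vertices of one piece that
-- are far apart, together with the breadth-first trees above them, span K_{s,s}.
--
-- For every choice of offsets, the certificates colour the vertices such that the
-- pieces are monochromatic components.  A vertex accepts if its edges are
-- rarely bichromatic and its monochromatic components have bounded weak diameter and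
-- belong to 𝒫.
-- If all vertices accept, then some choice makes at most s / k of all edges
-- bichromatic, and the other edges form a disjoint union of graphs in 𝒫.
module Submission where

open import Defs
open import Level using (0ℓ)
open import Axiom.ExcludedMiddle using (ExcludedMiddle)
open import Data.Bool.Base using (Bool; true; false; T; if_then_else_; _∧_; _xor_; not)
open import Data.Bool.Properties using (T?; T-∧)
open import Data.Empty using (⊥-elim)
open import Data.Fin.Base
  using (Fin; zero; suc; toℕ; combine; quotient; remainder; funToFin; finToFun; _↑ˡ_; _↑ʳ_;
         splitAt)
open import Data.Fin.Properties as Fin
  using (toℕ<n; toℕ-injective; toℕ-fromℕ<; combine-injective; remQuot-combine;
         finToFun-funToFin; splitAt-↑ˡ; splitAt-↑ʳ; ↑ˡ-injective; ↑ʳ-injective)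
open import Data.Fin.Subset using (Subset) renaming (_∈_ to _∈ˢ_)
open import Data.Integer.Base as ℤ using (+[1+_]; -[1+_])
import Data.Integer.Properties as ℤ
open import Data.List.Base
  using (List; []; _∷_; length; replicate; filterᵇ; allFin; cartesianProduct)
open import Data.List.Membership.Propositional using (_∈_)
open import Data.List.Membership.Propositional.Properties
  using (∈-filter⁺; ∈-cartesianProduct⁺; ∈-allFin; ∈-length)
open import Data.List.Properties using (length-replicate)
open import Data.List.Relation.Unary.Any using (here; there)
open import Data.Nat.Base hiding (parity)
open import Data.Nat.DivMod
open import Data.Nat.Divisibility using (∣-refl)
open import Data.Nat.Properties
open import Data.Nat.Tactic.RingSolver using (solve-∀)
open import Data.Product.Base
open import Data.Rational.Base as ℚ using (0ℚ; mkℚ; toℚᵘ; ↧ₙ_)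
import Data.Rational.Properties as ℚ
open import Data.Rational.Unnormalised.Base as ℚᵘ using (mkℚᵘ)
import Data.Rational.Unnormalised.Properties as ℚᵘ
open import Data.Sum.Base using (_⊎_; inj₁; inj₂; [_,_]′)
open import Data.Unit.Base using (⊤; tt)
open import Data.Vec.Base as Vec using ()
open import Data.Vec.Properties using ([]=⇒lookup; lookup⇒[]=; lookup∘tabulate)
open import Function.Base
open import Function.Bundles using (Equivalence; mk⇔)
open import Relation.Binary.Construct.Closure.ReflexiveTransitive as Star
  using (Star; ε; _◅_; _◅◅_)
open import Relation.Binary.Core using (Rel; _⇒_)
open import Relation.Binary.Definitions using (Symmetric; tri<; tri≈; tri>)
open import Relation.Binary.PropositionalEquality hiding ([_])
open import Relation.Nullary
open import Relation.Nullary.Decidable using (dec-true; dec-false; does-⇔; decidable-stable)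
open import Relation.Unary using (Pred)
open import Algebra.Properties.Semiring.Sum +-*-semiring
  using (sum; sum-cong-≗; ∑-distrib-+; *-distribˡ-sum; *-distribʳ-sum)

private variable
  l m n r s : ℕ
  u v w : Fin n
  E F : Rel (Fin n) 0ℓ

-- Walks and breadth-first layerings

-- The index only bounds the length, as in `Within`. An arbitrary relation replaces adjacency so
-- that walks can be confined to a vertex set or to descents.
data Walk {n} (E : Rel (Fin n) 0ℓ) : ℕ → Rel (Fin n) 0ℓ where
  []  : Walk E r u u
  _∷_ : E u v → Walk E r v w → Walk E (suc r) u w

walk-mono : r ≤ s → Walk E r u v → Walk E s u v
walk-mono _         []       = []
walk-mono (s≤s r≤s) (e ∷ es) = e ∷ walk-mono r≤s es

walk-++ : Walk E r u v → Walk E s v w → Walk E (r + s) u w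
walk-++ {r = r} {s = s} [] fs = walk-mono (m≤n+m s r) fs
walk-++ (e ∷ es)           fs = e ∷ walk-++ es fs

walk-∷ʳ : Walk E r u v → E v w → Walk E (suc r) u w
walk-∷ʳ []       f = f ∷ []
walk-∷ʳ (e ∷ es) f = e ∷ walk-∷ʳ es f

walk-sym : Symmetric E → Walk E r u v → Walk E r v u
walk-sym E-sym []       = []
walk-sym E-sym (e ∷ es) = walk-∷ʳ (walk-sym E-sym es) (E-sym e)

walk-map : E ⇒ F → Walk E r u v → Walk F r u v
walk-map f []       = []
walk-map f (e ∷ es) = f e ∷ walk-map f es

walk-zero : Walk E 0 u v → u ≡ v
walk-zero [] = refl

walk-uncons : Walk E (suc r) u w → u ≡ w ⊎ (∃[ v ] E u v × Walk E r v w)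
walk-uncons []       = inj₁ refl
walk-uncons (e ∷ es) = inj₂ (_ , e , es)

star⇒walk : Star E u v → ∃[ r ] Walk E r u v
star⇒walk ε        = 0 , []
star⇒walk (e ◅ es) = map suc (e ∷_) (star⇒walk es)

-- Cutting the walk at its first edge out of `P` and keeping the part before it locates where a
-- piece leaves a ball and where a descent leaves a range of levels.
exit : (P : Pred (Fin n) 0ℓ) → (∀ w → Dec (P w)) → P u → ¬ P v → Star E u v →
       ∃[ x ] ∃[ y ] Star E u x × P x × E x y × ¬ P y
exit P P? Pu ¬Pv ε = ⊥-elim (¬Pv Pu)
exit P P? Pu ¬Pv (_◅_ {j = w} e es) with P? w
... | no ¬Pw = _ , _ , ε , Pu , e , ¬Pw
... | yes Pw with x , y , es′ , Px , f , ¬Py ← exit P P? Pw ¬Pv es =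
  x , y , e ◅ es′ , Px , f , ¬Py

-- All components are layered at once, each from its own root. The fields are the consequences of
-- `level` being the distance to the root that the argument uses.
record Layering {n} (E : Rel (Fin n) 0ℓ) : Set where
  field
    root      : Fin n → Fin n
    level     : Fin n → ℕ
    root-adj  : E u v → root u ≡ root v
    level-adj : E u v → level u ≤ suc (level v)
    descend   : ∀ {d} → level u ≡ suc d → ∃[ v ] E u v × level v ≡ d
    bottom    : level u ≡ 0 → u ≡ root u

module _ (em : ExcludedMiddle 0ℓ) where

  least : (P : Pred ℕ 0ℓ) → ∃ P → ∃[ m ] P m × (∀ k → P k → m ≤ k)
  least P (w , Pw) = search w P Pw
    where
    search : ∀ w (P : Pred ℕ 0ℓ) → P w → ∃[ m ] P m × (∀ k → P k → m ≤ k)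
    search zero    P P0 = 0 , P0 , λ _ _ → z≤n
    search (suc w) P Pw with em {P 0}
    ... | yes P0 = 0 , P0 , λ _ _ → z≤n
    ... | no ¬P0 with m , Pm , min ← search w (P ∘ suc) Pw =
      suc m , Pm , λ { zero P0 → ⊥-elim (¬P0 P0) ; (suc k) Pk → s≤s (min k Pk) }

  module _ {n} {E : Rel (Fin n) 0ℓ} (E-sym : Symmetric E) where

    private
      -- The reachable vertex of least index depends only on the component, which makes it a
      -- canonical root.
      leastReachable : ∀ u → ∃[ m ] (∃[ v ] toℕ v ≡ m × Star E u v) ×
                         (∀ k → (∃[ v ] toℕ v ≡ k × Star E u v) → m ≤ k)
      leastReachable u = least (λ m → ∃[ v ] toℕ v ≡ m × Star E u v) (_ , u , refl , ε)

    representative : Fin n → Fin n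
    representative u = leastReachable u .proj₂ .proj₁ .proj₁

    representative-reachable : ∀ u → Star E u (representative u)
    representative-reachable u = leastReachable u .proj₂ .proj₁ .proj₂ .proj₂

    private
      representative-≤ : Star E u v → toℕ (representative v) ≤ toℕ (representative u)
      representative-≤ {u} {v} u⟶v
        with _ , (x , refl , u⟶x) , _   ← leastReachable u
           | _ , (y , refl , _  ) , min ← leastReachable v
        = min (toℕ x) (x , refl , Star.reverse E-sym u⟶v ◅◅ u⟶x)

    representative-cong : Star E u v → representative u ≡ representative v
    representative-cong u⟶v = toℕ-injective
      (≤-antisym (representative-≤ (Star.reverse E-sym u⟶v)) (representative-≤ u⟶v))

    layering : Layering E
    layering = record
      { root      = representative
      ; level     = level
      ; root-adj  = λ e → representative-cong (e ◅ ε)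
      ; level-adj = level-adj
      ; descend   = descend
      ; bottom    = bottom
      }
      where
      distance : ∀ u → ∃[ d ] Walk E d u (representative u) ×
                      (∀ k → Walk E k u (representative u) → d ≤ k)
      distance u = least (λ d → Walk E d u (representative u))
                         (star⇒walk (representative-reachable u))

      level : Fin n → ℕ
      level u = distance u .proj₁

      geodesic : ∀ u → Walk E (level u) u (representative u)
      geodesic u = distance u .proj₂ .proj₁

      level-min : ∀ {d} → Walk E d u (representative u) → level u ≤ d
      level-min {u} {d} = distance u .proj₂ .proj₂ d

      level-adj : E u v → level u ≤ suc (level v)
      level-adj {u} {v} e =
        level-min (e ∷ subst (Walk E _ v) (representative-cong (E-sym e ◅ ε)) (geodesic v))

      -- The second vertex of a geodesic works: the rest of the geodesic bounds its level from
      -- above, and `level-adj` bounds it from below.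
      descend : ∀ {d} → level u ≡ suc d → ∃[ v ] E u v × level v ≡ d
      descend {u} {d} eq with walk-uncons (subst (λ l → Walk E l u (representative u)) eq (geodesic u))
      ... | inj₁ u≡root =
        contradiction (subst (_≤ 0) eq (level-min (subst (Walk E 0 u) u≡root []))) λ ()
      ... | inj₂ (v , e , es) = v , e , ≤-antisym
        (level-min (subst (Walk E d v) (representative-cong (e ◅ ε)) es))
        (s≤s⁻¹ (subst (_≤ suc (level v)) eq (level-adj e)))

      bottom : level u ≡ 0 → u ≡ representative u
      bottom {u} eq = walk-zero (subst (λ l → Walk E l u (representative u)) eq (geodesic u))

-- Finite sums

sum-mono : (f g : Fin m → ℕ) → (∀ i → f i ≤ g i) → sum f ≤ sum g
sum-mono {zero}  f g f≤g = z≤n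
sum-mono {suc m} f g f≤g = +-mono-≤ (f≤g zero) (sum-mono (f ∘ suc) (g ∘ suc) (f≤g ∘ suc))

sum-const : ∀ m c → sum {m} (λ _ → c) ≡ m * c
sum-const zero    c = refl
sum-const (suc m) c = cong (c +_) (sum-const m c)

sum-↑ : ∀ m (f : Fin (m + l) → ℕ) → sum f ≡ sum (f ∘ (_↑ˡ l)) + sum (f ∘ (m ↑ʳ_))
sum-↑ zero    f = refl
sum-↑ (suc m) f = trans (cong (f zero +_) (sum-↑ m (f ∘ suc))) (sym (+-assoc (f zero) _ _))

sum-combine : ∀ m {l} (f : Fin (m * l) → ℕ) →
              sum f ≡ sum (λ (i : Fin m) → sum λ j → f (combine i j))
sum-combine zero        f = refl
sum-combine (suc m) {l} f =
  trans (sum-↑ l f) (cong (sum (f ∘ (_↑ˡ m * l)) +_) (sum-combine m (f ∘ (l ↑ʳ_))))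

sum-telescope : ∀ m (f : ℕ → ℕ) → (∀ x → f x ≤ f (suc x)) →
                sum {m} (λ i → ∣ f (toℕ i) - f (suc (toℕ i)) ∣) + f 0 ≡ f m
sum-telescope zero    f f-mono = refl
sum-telescope (suc m) f f-mono = begin
  ∣ f 0 - f 1 ∣ + Δ + f 0   ≡⟨ rearrange ∣ f 0 - f 1 ∣ Δ (f 0) ⟩
  Δ + (f 0 + ∣ f 0 - f 1 ∣) ≡⟨ cong (λ x → Δ + (f 0 + x)) (m≤n⇒∣m-n∣≡n∸m (f-mono 0)) ⟩
  Δ + (f 0 + (f 1 ∸ f 0))   ≡⟨ cong (Δ +_) (m+[n∸m]≡n (f-mono 0)) ⟩
  Δ + f 1                   ≡⟨ sum-telescope m (f ∘ suc) (f-mono ∘ suc) ⟩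
  f (suc m)                 ∎
  where
  open ≡-Reasoning
  Δ = sum {m} (λ i → ∣ f (suc (toℕ i)) - f (suc (suc (toℕ i))) ∣)
  rearrange : ∀ a b c → a + b + c ≡ b + (c + a)
  rearrange = solve-∀

-- Shifted interval partitions and block parities

module _ (k : ℕ) .{{_ : NonZero k}} where

  private
    -- As the offset runs through 0, ..., k - 1, the quotients climb from x / k to (k + x) / k, so
    -- the sum telescopes to 1.
    shifts : ∀ x → sum {k} (λ i → ∣ (toℕ i + x) / k - (toℕ i + suc x) / k ∣) ≡ 1
    shifts x = +-cancelʳ-≡ (x / k) _ 1 (begin
      sum {k} (λ i → ∣ (toℕ i + x) / k - (toℕ i + suc x) / k ∣) + x / k
        ≡⟨ cong (_+ x / k) (sum-cong-≗ {k} λ i →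
             cong (λ y → ∣ (toℕ i + x) / k - y / k ∣) (+-suc (toℕ i) x)) ⟩
      sum {k} (λ i → ∣ (toℕ i + x) / k - suc (toℕ i + x) / k ∣) + x / k
        ≡⟨ sum-telescope k (λ y → (y + x) / k) (λ y → /-monoˡ-≤ k (n≤1+n (y + x))) ⟩
      (k + x) / k
        ≡⟨ +-distrib-/-∣ˡ x ∣-refl ⟩
      k / k + x / k
        ≡⟨ cong (_+ x / k) (n/n≡1 k) ⟩
      1 + x / k ∎)
      where open ≡-Reasoning

  -- Among the k shifted partitions of ℕ into intervals of length k, at most one
  -- separates two given neighbours.
  separations : ∀ {x y} → x ≤ suc y → y ≤ suc x →
                sum {k} (λ i → ∣ (toℕ i + x) / k - (toℕ i + y) / k ∣) ≤ 1
  separations {x} {y} x≤1+y y≤1+x with m≤n⇒m<n∨m≡n x≤1+y | m≤n⇒m<n∨m≡n y≤1+x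
  ... | inj₂ refl | _ = ≤-reflexive (trans
    (sum-cong-≗ {k} λ i → ∣-∣-comm ((toℕ i + x) / k) ((toℕ i + y) / k)) (shifts y))
  ... | _ | inj₂ refl = ≤-reflexive (shifts x)
  ... | inj₁ x<1+y | inj₁ y<1+x with refl ← ≤-antisym (s≤s⁻¹ x<1+y) (s≤s⁻¹ y<1+x) =
    ≤-trans (≤-reflexive (trans
      (sum-cong-≗ {k} λ i → ∣n-n∣≡0 ((toℕ i + x) / k)) (trans (sum-const k 0) (*-zeroʳ k)))) z≤n

-- The indicator of inequality, hence the complement of the Kronecker delta; it counts cut edges.
δ : Fin m → Fin m → ℕ
δ a b = if does (a Fin.≟ b) then 0 else 1

δ≤1 : (a b : Fin m) → δ a b ≤ 1
δ≤1 a b with a Fin.≟ b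
... | yes _ = z≤n
... | no  _ = ≤-refl

δ-combine : (a : Fin l) (b c : Fin m) → δ (combine a b) (combine a c) ≤ δ b c
δ-combine a b c with b Fin.≟ c
... | no  _    = δ≤1 (combine a b) (combine a c)
... | yes refl with combine a b Fin.≟ combine a b
...   | yes _ = z≤n
...   | no ≢  = contradiction refl ≢

-- Adjacent vertices lie in equal or consecutive blocks, so one bit per round tells whether an edge
-- stays inside its block.
parity : ℕ → Fin 2
parity zero          = zero
parity (suc zero)    = suc zero
parity (suc (suc b)) = parity b

parity-suc : ∀ b → parity b ≢ parity (suc b)
parity-suc zero          ()
parity-suc (suc zero)    ()
parity-suc (suc (suc b)) = parity-suc b

parity-injective : ∀ {a b} → a ≤ suc b → b ≤ suc a → parity a ≡ parity b → a ≡ b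
parity-injective {a} {b} a≤1+b b≤1+a eq with m≤n⇒m<n∨m≡n a≤1+b | m≤n⇒m<n∨m≡n b≤1+a
... | inj₁ a<1+b | inj₁ b<1+a = ≤-antisym (s≤s⁻¹ a<1+b) (s≤s⁻¹ b<1+a)
... | inj₂ refl  | _          = contradiction (sym eq) (parity-suc b)
... | _          | inj₂ refl  = contradiction eq (parity-suc a)

-- Decomposition into pieces of bounded weak diameter

~-sym : (G : Graph n) → Symmetric (Graph._~_ G)
~-sym G {u} {v} = subst T (Graph.adj-sym G u v)

EdgeIn : Graph n → Pred (Fin n) 0ℓ → Rel (Fin n) 0ℓ
EdgeIn G W u v = W u × W v × Graph._~_ G u v

EdgeIn-sym : (G : Graph n) {W : Pred (Fin n) 0ℓ} → Symmetric (EdgeIn G W)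
EdgeIn-sym G (Wu , Wv , e) = Wv , Wu , ~-sym G e

module Decomposition {n} (G : Graph n) (layers : (W : Pred (Fin n) 0ℓ) → Layering (EdgeIn G W))
                     (k : ℕ) .{{_ : NonZero k}} where
  module Layers (W : Pred (Fin n) 0ℓ) = Layering (layers W)
  open Layers using (level)

  block : Pred (Fin n) 0ℓ → Fin k → Fin n → ℕ
  block W i v = (toℕ i + level W v) / k

  -- The next round layers not just block b but all of W from c layers before block b
  -- on, so that walks of length c from block b stay inside.  Vertices of the same
  -- block share this set, hence also its layering.
  Above : Pred (Fin n) 0ℓ → ℕ → Fin k → ℕ → Pred (Fin n) 0ℓ
  Above W c i b u = W u × b * k ≤ toℕ i + level W u + c

  above : ∀ W {c} i {v} → W v → Above W c i (block W i v) v
  above W i {v} Wv = Wv , ≤-trans (m/n*n≤m (toℕ i + level W v) k) (m≤m+n _ _)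

  -- The index j lists the s offsets as digits in base k, and the colour lists the s block parities
  -- as digits in base 2. The clearance grows by k because a descent from a block through
  -- `Above W c i b` can have up to c + k steps.
  colour : ∀ s → ℕ → Pred (Fin n) 0ℓ → Fin (k ^ s) → Fin n → Fin (2 ^ s)
  colour zero    c W j v = zero
  colour (suc s) c W j v =
    combine (parity (block W i v)) (colour s (c + k) (Above W c i (block W i v)) j′ v)
    where
    i  = quotient (k ^ s) j
    j′ = remainder {k} (k ^ s) j

  colour-combine : ∀ s {c W} i j v → colour (suc s) c W (combine i j) v ≡
    combine (parity (block W i v)) (colour s (c + k) (Above W c i (block W i v)) j v)
  colour-combine s {c} {W} i j v = cong
    (λ (i , j) → combine (parity (block W i v)) (colour s (c + k) (Above W c i (block W i v)) j v))
    (remQuot-combine i j)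

  -- At most one of the k first offsets separates the ends of the edge, and then all k ^ s later
  -- choices may cut it. For every other offset both ends share the next vertex set, and induction
  -- applies.
  cut-bound : ∀ s {c W u v} → EdgeIn G W u v →
              k * sum (λ j → δ (colour s c W j u) (colour s c W j v)) ≤ s * k ^ s
  cut-bound zero _ = ≤-reflexive (*-zeroʳ k)
  cut-bound (suc s) {c} {W} {u} {v} e@(Wu , Wv , u~v) = begin
    k * sum (λ j → δ (colour (suc s) c W j u) (colour (suc s) c W j v))
      ≡⟨ cong (k *_) (sum-combine k _) ⟩
    k * sum inner
      ≡⟨ *-distribˡ-sum k inner ⟩
    sum (λ i → k * inner i)
      ≤⟨ sum-mono _ _ inner-bound ⟩
    sum (λ i → s * k ^ s + separation i * k ^ suc s)
      ≡⟨ ∑-distrib-+ {k} (λ _ → s * k ^ s) (λ i → separation i * k ^ suc s) ⟩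
    sum {k} (λ _ → s * k ^ s) + sum (λ i → separation i * k ^ suc s)
      ≡⟨ cong₂ _+_ (sum-const k (s * k ^ s)) (sym (*-distribʳ-sum (k ^ suc s) separation)) ⟩
    k * (s * k ^ s) + sum separation * k ^ suc s
      ≤⟨ +-monoʳ-≤ (k * (s * k ^ s)) (*-monoˡ-≤ (k ^ suc s) (separations k
           (Layers.level-adj W e) (Layers.level-adj W (EdgeIn-sym G e)))) ⟩
    k * (s * k ^ s) + 1 * k ^ suc s
      ≡⟨ rearrange k s (k ^ s) ⟩
    suc s * k ^ suc s ∎
    where
    open ≤-Reasoning
    rearrange : ∀ k s x → k * (s * x) + 1 * (k * x) ≡ suc s * (k * x)
    rearrange = solve-∀
    inner separation : Fin k → ℕ
    inner i = sum λ j → δ (colour (suc s) c W (combine i j) u) (colour (suc s) c W (combine i j) v)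
    separation i = ∣ block W i u - block W i v ∣

    inner≤ : ∀ i → inner i ≤ k ^ s
    inner≤ i = ≤-trans (sum-mono {k ^ s} _ (λ _ → 1) λ j →
                         δ≤1 (colour (suc s) c W (combine i j) u) (colour (suc s) c W (combine i j) v))
                       (≤-reflexive (trans (sum-const (k ^ s) 1) (*-identityʳ (k ^ s))))

    inner-bound : ∀ i → k * inner i ≤ s * k ^ s + separation i * k ^ suc s
    -- For a separating offset the trivial bound `k ^ s` on the inner sum costs k * k ^ s, which the
    -- second summand pays.
    inner-bound i with block W i u ≟ block W i v
    ... | no b≢ = ≤-trans (*-monoʳ-≤ k (inner≤ i)) (≤-trans
      (subst (_≤ separation i * k ^ suc s) (*-identityˡ (k ^ suc s))
        (*-monoˡ-≤ (k ^ suc s) (n≢0⇒n>0 (b≢ ∘ ∣m-n∣≡0⇒m≡n))))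
      (m≤n+m _ (s * k ^ s)))
    ... | yes b≡ = ≤-trans (*-monoʳ-≤ k (sum-mono _ _ λ j → inner-same j)) (≤-trans
      (cut-bound s (above W i Wu , subst (λ b → Above W c i b v) (sym b≡) (above W i Wv) , u~v))
      (m≤m+n _ _))
      where
      inner-same : ∀ j → δ (colour (suc s) c W (combine i j) u) (colour (suc s) c W (combine i j) v)
        ≤ δ (colour s (c + k) (Above W c i (block W i u)) j u)
            (colour s (c + k) (Above W c i (block W i u)) j v)
      inner-same j rewrite colour-combine s {c} {W} i j u | colour-combine s {c} {W} i j v | sym b≡ =
        δ-combine (parity (block W i u)) _ _

-- Complete bipartite minors from far-apart vertices of a piece

module Structure {n} (G : Graph n) (layers : (W : Pred (Fin n) 0ℓ) → Layering (EdgeIn G W))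
                 (k : ℕ) .{{_ : NonZero k}} where
  open Graph G using (_~_)
  open Decomposition G layers k
  open Layers using (level; root)

  private variable
    t c : ℕ
    W : Pred (Fin n) 0ℓ

  Monochromatic : ∀ s → ℕ → Pred (Fin n) 0ℓ → Fin (k ^ s) → Rel (Fin n) 0ℓ
  Monochromatic s c W j u v = EdgeIn G W u v × colour s c W j u ≡ colour s c W j v

  block-adj : ∀ i → EdgeIn G W u v → block W i u ≤ suc (block W i v)
  block-adj {W} {u} {v} i e = begin
    (toℕ i + level W u) / k         ≤⟨ /-monoˡ-≤ k (+-monoʳ-≤ (toℕ i) (Layers.level-adj W e)) ⟩
    (toℕ i + suc (level W v)) / k   ≡⟨ cong (_/ k) (+-suc (toℕ i) (level W v)) ⟩
    (1 + (toℕ i + level W v)) / k   ≤⟨ /-monoˡ-≤ k (+-monoˡ-≤ _ (>-nonZero⁻¹ k)) ⟩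
    (k + (toℕ i + level W v)) / k   ≡⟨ m+n/m≡1+n/m ⟩
    suc ((toℕ i + level W v) / k)   ∎
    where
    open ≤-Reasoning
    m+n/m≡1+n/m : (k + (toℕ i + level W v)) / k ≡ suc ((toℕ i + level W v) / k)
    m+n/m≡1+n/m = trans (+-distrib-/-∣ˡ (toℕ i + level W v) ∣-refl) 
      (cong (_+ (toℕ i + level W v) / k) (n/n≡1 k))

  -- Equal parities force equal blocks along an edge, so a piece never leaves its block, and the
  -- remaining digits of the colour all refer to the same set `Above W c i b`.
  monochromatic-step : ∀ s c {j b} → let i = quotient (k ^ s) j ; j′ = remainder {k} (k ^ s) j in
    Monochromatic (suc s) c W j u v → block W i u ≡ b →
    block W i v ≡ b × Monochromatic s (c + k) (Above W c i b) j′ u v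
  monochromatic-step {W} {u} {v} s c {j} (e@(Wu , Wv , u~v) , same) refl
    with parities , colours ← combine-injective (parity (block W (quotient (k ^ s) j) u)) _ _ _ same
    = sym b≡
    , (above W i Wu , subst (λ b → Above W c i b v) (sym b≡) (above W i Wv) , u~v)
    , trans colours (cong (λ b → colour s (c + k) (Above W c i b) j′ v) (sym b≡))
    where
    i  = quotient (k ^ s) j
    j′ = remainder {k} (k ^ s) j
    b≡ : block W i u ≡ block W i v
    b≡ = parity-injective (block-adj i e) (block-adj i (EdgeIn-sym G e)) parities

  monochromatic-star : ∀ s c {j b} → let i = quotient (k ^ s) j ; j′ = remainder {k} (k ^ s) j in
    Star (Monochromatic (suc s) c W j) u v → block W i u ≡ b →
    block W i v ≡ b × Star (Monochromatic s (c + k) (Above W c i b) j′) u v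
  monochromatic-star s c ε        b≡ = b≡ , ε
  monochromatic-star s c (e ◅ es) b≡ with b≡′ , e′ ← monochromatic-step s c e b≡ =
    map₂ (e′ ◅_) (monochromatic-star s c es b≡′)

  Down : Pred (Fin n) 0ℓ → Rel (Fin n) 0ℓ
  Down W u v = EdgeIn G W u v × level W u ≡ suc (level W v)

  down-level : Star (Down W) u v → level W v ≤ level W u
  down-level ε              = ≤-refl
  down-level ((_ , eq) ◅ es) = ≤-trans (down-level es) (≤-trans (n≤1+n _) (≤-reflexive (sym eq)))

  down-closed : W u → Star (Down W) u v → W v
  down-closed Wu ε                        = Wu
  down-closed Wu (((_ , Ww , _) , _) ◅ es) = down-closed Ww es

  -- Every step lowers the level by exactly one, so the drop in level bounds the length. The
  -- relation `S` lets the walk keep facts about its edges beyond descent.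
  down-walk : (S : Rel (Fin n) 0ℓ) → S ⇒ Down W → Star S u v → level W u ≤ level W v + m → Walk S m u v
  down-walk S S⇒ ε _ = []
  down-walk {W} {u} {v} {zero} S S⇒ (e ◅ es) le = contradiction
    (≤-trans (≤-reflexive (sym (S⇒ e .proj₂))) (≤-trans le (≤-trans (≤-reflexive (+-identityʳ _)) (down-level (Star.map S⇒ es)))))
    (<-irrefl refl)
  down-walk {W} {u} {v} {suc m} S S⇒ (e ◅ es) le = e ∷ down-walk S S⇒ es
    (s≤s⁻¹ (≤-trans (≤-reflexive (sym (S⇒ e .proj₂))) (≤-trans le (≤-reflexive (+-suc _ m)))))

  root-star : Star (EdgeIn G W) u v → root W u ≡ root W v
  root-star ε        = refl
  root-star (e ◅ es) = trans (Layers.root-adj _ e) (root-star es)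

  down-to-root : ∀ W u → Star (Down W) u (root W u) × level W (root W u) ≡ 0
  down-to-root W u = go (level W u) u refl
    where
    go : ∀ d u → level W u ≡ d → Star (Down W) u (root W u) × level W (root W u) ≡ 0
    go zero    u eq = subst (λ r → Star (Down W) u r × level W r ≡ 0) (Layers.bottom W eq) (ε , eq)
    go (suc d) u eq with v , e , eq′ ← Layers.descend W eq
      rewrite Layers.root-adj W e =
      map₁ ((e , trans eq (cong suc (sym eq′))) ◅_) (go d v eq′)

  walk-level : Walk (EdgeIn G W) r u v → level W u ≤ r + level W v
  walk-level []       = m≤n+m _ _
  walk-level (e ∷ es) = ≤-trans (Layers.level-adj _ e) (s≤s (walk-level es))

  -- A model of K_{s,t} with branch sets A and B.  The clearance c keeps the A away
  -- from the descents by which the enclosing rounds extend the B.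
  record Grid (s c R : ℕ) (W : Pred (Fin n) 0ℓ) (x : Fin t → Fin n) : Set₁ where
    field
      A              : Fin s → Pred (Fin n) 0ℓ
      B              : Fin t → Pred (Fin n) 0ℓ
      hub            : Fin s → Fin n
      hub∈A          : ∀ l → A l (hub l)
      A-connected    : ∀ l → A l u → Star (EdgeIn G (A l)) (hub l) u
      centre∈B       : ∀ i → B i (x i)
      B-connected    : ∀ i → B i u → Star (EdgeIn G (B i)) (x i) u
      A⊆W            : ∀ l → A l u → W u
      B⊆W            : ∀ i → B i u → W u
      B-near         : ∀ i → B i u → Walk _~_ R (x i) u
      A-disjoint     : ∀ l l′ → A l u → A l′ u → l ≡ l′
      A-B-disjoint   : ∀ l i → A l u → ¬ B i u
      touch          : ∀ l i → ∃[ a ] ∃[ b ] A l a × B i b × a ~ b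
      clear          : ∀ l i → Walk (EdgeIn G W) c (x i) u → ¬ A l u

  -- Induction on the rounds: the remaining rounds yield a grid inside `W′`, and the current round
  -- adds the branch set `A₀` and extends each `B i` by a tail. The bound on `c + s * k` keeps the
  -- tails of all rounds within R; `ρ-low` compares two of the vertices, whence `2 + t`.
  grid : ∀ s {R c W j v} {x : Fin (2 + t) → Fin n} → c + s * k ≤ R → (∀ i → W (x i)) →
         (∀ i → Star (Monochromatic s c W j) v (x i)) →
         (∀ i i′ → Walk _~_ (R + R) (x i) (x i′) → i ≡ i′) →
         Grid s c R W x
  grid zero {x = x} _ Wx _ _ = record
    { A            = λ ()
    ; B            = λ i u → x i ≡ u
    ; hub          = λ ()
    ; hub∈A        = λ ()
    ; A-connected  = λ ()
    ; centre∈B     = λ _ → refl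
    ; B-connected  = λ { _ refl → ε }
    ; A⊆W          = λ ()
    ; B⊆W          = λ { i refl → Wx i }
    ; B-near       = λ { _ refl → [] }
    ; A-disjoint   = λ ()
    ; A-B-disjoint = λ ()
    ; touch        = λ ()
    ; clear        = λ ()
    }
  grid {t} (suc s) {R} {c} {W} {j} {v} {x} c+sk≤R Wx connected far = record
    { A            = λ { zero → A₀ ; (suc l) → A l }
    ; B            = λ i u → B i u ⊎ Tail i u
    ; hub          = λ { zero → ρ ; (suc l) → hub l }
    ; hub∈A        = λ { zero → ρ∈A₀ ; (suc l) → hub∈A l }
    ; A-connected  = λ { zero → A₀-connected ; (suc l) → A-connected l }
    ; centre∈B     = λ i → inj₁ (centre∈B i)
    ; B-connected  = λ i → [ Star.map (λ (p , q , e) → inj₁ p , inj₁ q , e) ∘ B-connected i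
                           , (λ (π , hu) → Star.map (λ (p , q , e) → inj₂ p , inj₂ q , e) (tail-connected i ε π hu)) ]′
    ; A⊆W          = λ { zero ((i , π) , _) → down-closed (Wx i) π ; (suc l) a → A⊆W l a .proj₁ }
    ; B⊆W          = λ i → [ proj₁ ∘ B⊆W i , (λ (π , _) → down-closed (Wx i) π) ]′
    ; B-near       = λ i → [ B-near i , (λ τ → walk-map (proj₂ ∘ proj₂) (walk-mono c+k≤R (tail-walk i τ))) ]′
    ; A-disjoint   = λ { zero zero _ _ → refl
                       ; zero (suc l) (_ , low) a → contradiction (A⊆W l a .proj₂) low
                       ; (suc l) zero a (_ , low) → contradiction (A⊆W l a .proj₂) low
                       ; (suc l) (suc l′) a a′ → cong suc (A-disjoint l l′ a a′) }
    ; A-B-disjoint = λ { zero i (_ , low) → [ low ∘ proj₂ ∘ B⊆W i , low ∘ proj₂ ]′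
                       -- A tail is a walk of length c + k inside `W′`, and c + k is the clearance
                       -- of the recursive call.
                       ; (suc l) i a → [ A-B-disjoint l i a
                                       , (λ τ → clear l i (tail-walk i τ) a) ]′ }
    ; touch        = λ { zero → touch₀
                       ; (suc l) i → map₂ (map₂ λ (a , b , e) → a , inj₁ b , e) (touch l i) }
    -- The slack c in `High` keeps walks of length c from the x i inside `W′`: they miss `A₀`, and
    -- the clearance of the recursive call covers the other sets.
    ; clear        = λ { zero i es (_ , low) → low (near-high i es)
                       ; (suc l) i es a → clear l i (walk-mono (m≤m+n c k) (near-above i es)) a }
    }
    where
    o = quotient (k ^ s) j
    b = block W o v
    L = level W

    High : Pred (Fin n) 0ℓ
    High u = b * k ≤ toℕ o + L u + c

    b≡ : ∀ i → block W o (x i) ≡ b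
    b≡ i = monochromatic-star s c (connected i) refl .proj₁

    x-high : ∀ i → b * k ≤ toℕ o + L (x i)
    x-high i = subst (λ b → b * k ≤ toℕ o + L (x i)) (b≡ i) (m/n*n≤m (toℕ o + L (x i)) k)

    W′ = Above W c o b

    c+k≤R : c + k ≤ R
    c+k≤R = ≤-trans (+-monoʳ-≤ c (m≤m+n k (s * k))) c+sk≤R

    open Grid (grid {t} s {R} {c + k} {W′} {remainder {k} (k ^ s) j} {v} {x}
                (≤-trans (≤-reflexive (+-assoc c k (s * k))) c+sk≤R)
                (λ i → Wx i , ≤-trans (x-high i) (m≤m+n _ c))
                (λ i → monochromatic-star s c (connected i) refl .proj₂)
                far)

    ρ = root W (x zero)

    -- The new branch set A₀ consists of the parts outside W′ of the descents from the
    -- x i to their common root ρ; the parts inside W′ are short and extend the B i.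
    A₀ : Pred (Fin n) 0ℓ
    A₀ u = (∃[ i ] Star (Down W) (x i) u) × ¬ High u

    Tail : Fin (2 + t) → Pred (Fin n) 0ℓ
    Tail i u = Star (Down W) (x i) u × High u

    high-mono : L u ≤ L w → High u → High w
    high-mono le hu = ≤-trans hu (+-monoˡ-≤ c (+-monoʳ-≤ (toℕ o) le))

    -- The shifted level of x i exceeds the start of its block by less than k, and a high vertex
    -- lies at most c below that start.
    tail-length : ∀ i → High u → L (x i) ≤ L u + (c + k)
    tail-length {u} i hu = +-cancelˡ-≤ (toℕ o) _ _ (begin
      toℕ o + L (x i)                 ≡⟨ m≡m%n+[m/n]*n (toℕ o + L (x i)) k ⟩
      _ + block W o (x i) * k         ≤⟨ +-mono-≤ (<⇒≤ (m%n<n (toℕ o + L (x i)) k))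
                                                  (≤-trans (≤-reflexive (cong (_* k) (b≡ i))) hu) ⟩
      k + (toℕ o + L u + c)           ≡⟨ rearrange k (toℕ o) (L u) c ⟩
      toℕ o + (L u + (c + k))         ∎)
      where
      open ≤-Reasoning
      rearrange : ∀ k o l c → k + (o + l + c) ≡ o + (l + (c + k))
      rearrange = solve-∀

    tail-above : W u → Star (Down W) u w → High w → Star (λ y z → Down W y z × EdgeIn G W′ y z) u w
    tail-above Wu ε hw = ε
    tail-above Wu π@(e@((_ , Wy , u~y) , _) ◅ es) hw =
      (e , (Wu , high-mono (down-level π) hw) , (Wy , high-mono (down-level es) hw) , u~y) ◅
      tail-above Wy es hw

    tail-walk : ∀ i → Tail i u → Walk (EdgeIn G W′) (c + k) (x i) u
    tail-walk i (π , hu) =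
      walk-map proj₂ (down-walk _ proj₁ (tail-above (Wx i) π hu) (tail-length i hu))

    -- The descent π already made is carried along, since it witnesses that the vertices met later
    -- belong to `Tail i`.
    tail-connected : ∀ i → Star (Down W) (x i) u → Star (Down W) u w → High w →
                     Star (EdgeIn G (Tail i)) u w
    tail-connected i π ε        hw = ε
    tail-connected i π (e ◅ es) hw =
      ( (π , high-mono (down-level (e ◅ es)) hw)
      , (π ◅◅ e ◅ ε , high-mono (down-level es) hw)
      , e .proj₁ .proj₂ .proj₂) ◅ tail-connected i (π ◅◅ e ◅ ε) es hw

    x-root : ∀ i → root W (x i) ≡ ρ
    x-root i = trans (sym (v-root i)) (v-root zero)
      where
      v-root : ∀ i → root W v ≡ root W (x i)
      v-root i = root-star (Star.map proj₁ (connected i))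

    x-down : ∀ i → Star (Down W) (x i) ρ
    x-down i = subst (Star (Down W) (x i)) (x-root i) (down-to-root W (x i) .proj₁)

    -- Otherwise the whole descents to ρ would be tails, of length at most R, and would join two
    -- distinct x i by a walk of length 2R.
    ρ-low : ¬ High ρ
    ρ-low hρ with far zero (suc zero) (walk-++ (to-ρ zero) (walk-sym (~-sym G) (to-ρ (suc zero))))
      where
      to-ρ : ∀ i → Walk _~_ R (x i) ρ
      to-ρ i = walk-map (proj₂ ∘ proj₂) (walk-mono c+k≤R (tail-walk i (x-down i , hρ)))
    ... | ()

    ρ∈A₀ : A₀ ρ
    ρ∈A₀ = (zero , x-down zero) , ρ-low

    low-connected : A₀ u → Star (Down W) u w → Star (EdgeIn G A₀) u w
    low-connected a ε = ε
    low-connected a@((i , π) , low) (e ◅ es) = (a , a′ , e .proj₁ .proj₂ .proj₂) ◅ low-connected a′ es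
      where a′ = (i , π ◅◅ e ◅ ε) , low ∘ high-mono (down-level (e ◅ ε))

    -- Levels only fall along a descent, so descending further from a vertex of `A₀` stays in `A₀`
    -- until the common root is reached.
    A₀-connected : A₀ u → Star (EdgeIn G A₀) ρ u
    A₀-connected {u} a@((i , π) , _) = Star.reverse (EdgeIn-sym G) (low-connected a
      (subst (Star (Down W) u)
             (trans (sym (root-star (Star.map proj₁ π))) (x-root i))
             (down-to-root W u .proj₁)))

    touch₀ : ∀ i → ∃[ a ] ∃[ b ] A₀ a × (B i b ⊎ Tail i b) × a ~ b
    -- The descent from x i starts high and ends at the low root; the edge where it first becomes
    -- low joins `Tail i` to `A₀`.
    touch₀ i with y , z , π , hy , e , low ← exit High (λ u → _ ≤? _)
      (≤-trans (x-high i) (m≤m+n _ c)) ρ-low (x-down i) =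
      z , y , ((i , π ◅◅ e ◅ ε) , low) , inj₂ (π , hy) , ~-sym G (e .proj₁ .proj₂ .proj₂)

    near-high : ∀ i → Walk (EdgeIn G W) c (x i) u → High u
    near-high {u} i es = begin
      b * k                ≤⟨ x-high i ⟩
      toℕ o + L (x i)      ≤⟨ +-monoʳ-≤ (toℕ o) (walk-level es) ⟩
      toℕ o + (c + L u)    ≡⟨ cong (toℕ o +_) (+-comm c (L u)) ⟩
      toℕ o + (L u + c)    ≡⟨ +-assoc (toℕ o) (L u) c ⟨
      toℕ o + L u + c      ∎
      where open ≤-Reasoning

    -- The margin of the current vertex stays at least the remaining length, since each step costs
    -- at most one level.
    restrict : b * k + r ≤ toℕ o + L u + c → Walk (EdgeIn G W) r u w → Walk (EdgeIn G W′) r u w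
    restrict le [] = []
    restrict {suc r} {u} le (_∷_ {v = y} e@(Wu , Wy , u~y) es) =
      ((Wu , ≤-trans (m≤m+n (b * k) (suc r)) le) , (Wy , ≤-trans (m≤m+n (b * k) r) le′) , u~y) ∷
      restrict le′ es
      where
      open ≤-Reasoning
      le′ : b * k + r ≤ toℕ o + L y + c
      le′ = s≤s⁻¹ (begin
        suc (b * k + r)            ≡⟨ +-suc (b * k) r ⟨
        b * k + suc r              ≤⟨ le ⟩
        toℕ o + L u + c            ≤⟨ +-monoˡ-≤ c (+-monoʳ-≤ (toℕ o) (Layers.level-adj W e)) ⟩
        toℕ o + suc (L y) + c      ≡⟨ cong (_+ c) (+-suc (toℕ o) (L y)) ⟩
        suc (toℕ o + L y + c)      ∎)

    near-above : ∀ i → Walk (EdgeIn G W) c (x i) u → Walk (EdgeIn G W′) c (x i) u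
    near-above i = restrict (+-monoˡ-≤ c (x-high i))

-- Excluded minors bound the weak diameter

module Minors (em : ExcludedMiddle 0ℓ) where

  subset : ∀ {n} → Pred (Fin n) 0ℓ → Subset n
  subset P = Vec.tabulate λ u → does (em {P u})

  ∈-subset⁺ : ∀ {n} (P : Pred (Fin n) 0ℓ) {u} → P u → u ∈ˢ subset P
  ∈-subset⁺ P {u} Pu = lookup⇒[]= u _ (trans (lookup∘tabulate _ u) (dec-true em Pu))

  ∈-subset⁻ : ∀ {n} (P : Pred (Fin n) 0ℓ) {u} → u ∈ˢ subset P → P u
  ∈-subset⁻ P {u} u∈ with em {P u} | trans (sym (lookup∘tabulate (λ u → does (em {P u})) u)) ([]=⇒lookup u∈)
  ... | yes Pu | _  = Pu
  ... | no  _  | ()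

  layers : ∀ {n} (G : Graph n) (W : Pred (Fin n) 0ℓ) → Layering (EdgeIn G W)
  layers G W = layering em (EdgeIn-sym G)

  module _ {n} (G : Graph n) (k : ℕ) .{{_ : NonZero k}} where
    open Graph G using (_~_)
    open Structure G (layers G) k
    open Decomposition G (layers G) k using (colour)

    subset-connected : ∀ {P : Pred (Fin n) 0ℓ} {h} → P h → (∀ {u} → P u → Star (EdgeIn G P) h u) →
                       ConnectedOn G (subset P)
    subset-connected {P} {h} Ph h⟶ = (h , ∈-subset⁺ P Ph) , λ u∈ v∈ →
      Star.map (λ (Px , Py , e) → e , ∈-subset⁺ P Px , ∈-subset⁺ P Py)
        (Star.reverse (EdgeIn-sym G) (h⟶ (∈-subset⁻ P u∈)) ◅◅ h⟶ (∈-subset⁻ P v∈))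

    -- Contracting a perfect matching turns K_{s,s} into K_s.
    grid⇒minor : ∀ {s c R W} {x : Fin (2 + s) → Fin n} → Grid s c R W x →
                 (∀ i i′ → Walk _~_ (R + R) (x i) (x i′) → i ≡ i′) → (H : Graph s) → H ≼ G
    grid⇒minor {s} {x = x} grid far H = record
      { branch    = λ l → subset (Branch l)
      ; connected = λ l → subset-connected (inj₁ (hub∈A l)) (Branch-connected l)
      ; disjoint  = λ {l} {l′} u∈ u∈′ →
          Branch-disjoint l l′ (∈-subset⁻ (Branch l) u∈) (∈-subset⁻ (Branch l′) u∈′)
      ; edge      = λ {l} {l′} _ → let a , b , Aa , Bb , e = touch l (row l′) in
          a , b , ∈-subset⁺ (Branch l) (inj₁ Aa) , ∈-subset⁺ (Branch l′) (inj₂ Bb) , e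
      }
      where
      open Grid grid
      -- Of the 2 + s sets `B`, the last s are matched with the sets `A`.
      row : Fin s → Fin (2 + s)
      row l = suc (suc l)

      Branch : Fin s → Pred (Fin n) 0ℓ
      Branch l u = A l u ⊎ B (row l) u

      Branch-connected : ∀ l {u} → Branch l u → Star (EdgeIn G (Branch l)) (hub l) u
      Branch-connected l (inj₁ a) = Star.map (λ (p , q , e) → inj₁ p , inj₁ q , e) (A-connected l a)
      Branch-connected l (inj₂ b) with y , z , Ay , Bz , e ← touch l (row l) =
        Branch-connected l (inj₁ Ay) ◅◅ (inj₁ Ay , inj₂ Bz , e) ◅
        Star.map (λ (p , q , e) → inj₂ p , inj₂ q , e)
          (Star.reverse (EdgeIn-sym G) (B-connected (row l) Bz) ◅◅ B-connected (row l) b)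

      Branch-disjoint : ∀ l l′ {u} → Branch l u → Branch l′ u → l ≡ l′
      Branch-disjoint l l′ (inj₁ a) (inj₁ a′) = A-disjoint l l′ a a′
      Branch-disjoint l l′ (inj₁ a) (inj₂ b′) = contradiction b′ (A-B-disjoint l (row l′) a)
      Branch-disjoint l l′ (inj₂ b) (inj₁ a′) = contradiction b (A-B-disjoint l′ (row l) a′)
      -- Disjointness of the `B` comes from distance: two that meet would join their centres by a
      -- walk of length 2R.
      Branch-disjoint l l′ (inj₂ b) (inj₂ b′) = Fin.suc-injective (Fin.suc-injective
        (far (row l) (row l′) (walk-++ (B-near (row l) b) (walk-sym (~-sym G) (B-near (row l′) b′)))))

    -- If u is too far from v, the monochromatic walk leaves 2 + s concentric balls whose radii are
    -- the multiples of 2R + 1. The points just outside them are pairwise more than 2R apart and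
    -- span a grid, which contains `H` as a minor.
    weak-diameter : ∀ s {j : Fin (k ^ s)} {u v} {H : Graph s} → ¬ (H ≼ G) →
                    Star (Monochromatic s 0 (λ _ → ⊤) j) v u →
                    Walk _~_ ((2 + s) * suc (s * k + s * k)) v u
    weak-diameter s {j} {u} {v} {H} ¬minor π with em {Walk _~_ ((2 + s) * suc (s * k + s * k)) v u}
    ... | yes near = near
    ... | no ¬near = contradiction (grid⇒minor
      (grid s ≤-refl (λ _ → tt) (λ i → exits i .proj₂ .proj₁) far) far H) ¬minor
      where
      -- The clearance starts at 0 and grows by k in each of s rounds, so `s * k` bounds the reach
      -- of every `B`.
      R = s * k
      Ball : ℕ → Pred (Fin n) 0ℓ
      Ball i = Walk _~_ (i * suc (R + R)) v

      exits : ∀ (i : Fin (2 + s)) → ∃[ z ] Star (Monochromatic s 0 (λ _ → ⊤) j) v z ×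
                        Walk _~_ (suc (toℕ i * suc (R + R))) v z × ¬ Ball (toℕ i) z
      exits i with y , z , ρ , near , e , ¬near′ ← exit (Ball (toℕ i)) (λ _ → em) []
                     (¬near ∘ walk-mono (*-monoˡ-≤ (suc (R + R)) (<⇒≤ (toℕ<n i)))) π =
        z , ρ ◅◅ e ◅ ε , walk-∷ʳ near (e .proj₁ .proj₂ .proj₂) , ¬near′

      x : Fin (2 + s) → Fin n
      x i = exits i .proj₁

      separated : ∀ i i′ → toℕ i < toℕ i′ → ¬ Walk _~_ (R + R) (x i) (x i′)
      separated i i′ i<i′ es = exits i′ .proj₂ .proj₂ .proj₂ (walk-mono
        (begin
          suc (toℕ i * suc (R + R)) + (R + R)  ≡⟨ +-suc (toℕ i * suc (R + R)) (R + R) ⟨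
          toℕ i * suc (R + R) + suc (R + R)    ≡⟨ +-comm _ (suc (R + R)) ⟩
          suc (toℕ i) * suc (R + R)            ≤⟨ *-monoˡ-≤ (suc (R + R)) i<i′ ⟩
          toℕ i′ * suc (R + R)                 ∎)
        (walk-++ (exits i .proj₂ .proj₂ .proj₁) es))
        where open ≤-Reasoning

      far : ∀ i i′ → Walk _~_ (R + R) (x i) (x i′) → i ≡ i′
      far i i′ es with Fin.<-cmp i i′
      ... | tri< i<i′ _ _ = contradiction es (separated i i′ i<i′)
      ... | tri≈ _ i≡i′ _ = i≡i′
      ... | tri> _ _ i>i′ = contradiction (walk-sym (~-sym G) es) (separated i′ i i>i′)

-- Local verification

within⇒walk : {G : Graph n} → Within G r u v → Walk (Graph._~_ G) r u v
within⇒walk here        = []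
within⇒walk (step e es) = e ∷ within⇒walk es

walk⇒within : {G : Graph n} → Walk (Graph._~_ G) r u v → Within G r u v
walk⇒within []       = here
walk⇒within (e ∷ es) = step e (walk⇒within es)

size-bound : ∀ K (P : Proof n) → (∀ v → length (P v) ≤ K) → size P ≤ K
size-bound {zero}  K P P≤K = z≤n
size-bound {suc n} K P P≤K = ⊔-lub (P≤K zero) (size-bound K (P ∘ suc) (P≤K ∘ suc))

-- A certificate is the unary code of a table of C-colours indexed by Fin N.
module Certificates (N C : ℕ) .{{_ : NonZero C}} where

  private instance
    C^N≢0 : NonZero (C ^ N)
    C^N≢0 = m^n≢0 C N

  encode : (Fin N → Fin C) → List Bool
  encode f = replicate (toℕ (funToFin f)) true

  -- Lengths are reduced modulo `C ^ N` so that every certificate, even an adversarial one, denotes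
  -- some table.
  decode : List Bool → Fin N → Fin C
  decode bs = finToFun (length bs mod (C ^ N))

  decode-encode : ∀ f → decode (encode f) ≗ f
  decode-encode f j = trans (cong (λ i → finToFun i j) (toℕ-injective (begin
    toℕ (length (encode f) mod (C ^ N)) ≡⟨ toℕ-fromℕ< _ ⟩
    length (encode f) % (C ^ N)         ≡⟨ cong (_% (C ^ N)) (length-replicate (toℕ (funToFin f))) ⟩
    toℕ (funToFin f) % (C ^ N)          ≡⟨ m<n⇒m%n≡m (toℕ<n (funToFin f)) ⟩
    toℕ (funToFin f)                    ∎))) (finToFun-funToFin f j)
    where open ≡-Reasoning

  encode-length : ∀ f → length (encode f) ≤ C ^ N
  encode-length f = ≤-trans (≤-reflexive (length-replicate (toℕ (funToFin f)))) (<⇒≤ (toℕ<n (funToFin f)))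

module Verification (N C s k D : ℕ) .{{_ : NonZero C}} (𝒫 : GraphClass) where
  open Certificates N C

  Same : Graph n → Proof n → Fin N → Rel (Fin n) 0ℓ
  Same G P j u v = Graph._~_ G u v × decode (P u) j ≡ decode (P v) j

  -- Injectivity is only required at the ends of edges, so H may have any number
  -- of further isolated vertices.
  record PieceAt (G : Graph n) (P : Proof n) (j : Fin N) (v : Fin n) (H : Graph m) : Set where
    field
      embed     : Fin m → Fin n
      component : ∀ x → Star (Same G P j) v (embed x)
      edge      : ∀ {x y} → Graph._~_ H x y → Graph._~_ G (embed x) (embed y)
      injective : ∀ {x x′ y y′} → Graph._~_ H x x′ → Graph._~_ H y y′ → embed x ≡ embed y → x ≡ y

  -- The cuts are bounded on average over all j, since no single vertex can tell which j is globally
  -- good. Testing every graph that maps into the component, instead of the component itself, makes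
  -- the condition independent of vertex names.
  record Accepts (G : Graph n) (P : Proof n) (v : Fin n) : Set where
    field
      few-cuts : ∀ u → Graph._~_ G v u → k * sum (λ j → δ (decode (P v) j) (decode (P u) j)) ≤ s * N
      near     : ∀ j u → Star (Same G P j) v u → Walk (Graph._~_ G) D v u
      pieces   : ∀ j {m} (H : Graph m) → PieceAt G P j v H → 𝒫 H

  module _ {G : LabelledGraph n} {P : Proof n} {v : Fin n}
           {H : LabelledGraph m} {Q : Proof m} {w : Fin m} (ball : IsBall (suc D) G P v H Q w) where
    open IsBall ball renaming (injective to embed-injective)
    private
      open Graph (graph G) using () renaming (_~_ to _~ᴳ_)
      open Graph (graph H) using () renaming (_~_ to _~ᴴ_)
      Sameᴳ = Same (graph G) P
      Sameᴴ = Same (graph H) Q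

      push : ∀ {x y} → x ~ᴴ y → embed x ~ᴳ embed y
      push {x} {y} = subst T (induced x y)

      pull : ∀ {x y} → embed x ~ᴳ embed y → x ~ᴴ y
      pull {x} {y} = subst T (sym (induced x y))

      decode≡ : ∀ x → decode (Q x) ≡ decode (P (embed x))
      decode≡ x = cong decode (certs x)

      push-same : ∀ {j x y} → Sameᴴ j x y → Sameᴳ j (embed x) (embed y)
      push-same {j} {x} {y} (e , c) =
        push e , subst₂ (λ f g → f j ≡ g j) (decode≡ x) (decode≡ y) c

      pull-same : ∀ {j x y} → Sameᴳ j (embed x) (embed y) → Sameᴴ j x y
      pull-same {j} {x} {y} (e , c) =
        pull e , subst₂ (λ f g → f j ≡ g j) (sym (decode≡ x)) (sym (decode≡ y)) c

      push-walk : ∀ {x y} → Walk _~ᴴ_ r x y → Walk _~ᴳ_ r (embed x) (embed y)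
      push-walk []       = []
      push-walk (e ∷ es) = push e ∷ push-walk es

      covered : ∀ {u} → Walk _~ᴳ_ (suc D) v u → ∃[ x ] embed x ≡ u
      covered {u} es = Equivalence.to (image u) (walk⇒within es)

      -- A walk of length b from the centre to the current vertex is carried along; together with
      -- the a steps left it shows that every vertex met lies in the ball.
      pull-walk : ∀ {a b x u} → a + b ≤ suc D → Walk _~ᴳ_ b v (embed x) →
                  Walk _~ᴳ_ a (embed x) u → ∃[ y ] embed y ≡ u × Walk _~ᴴ_ a x y
      pull-walk le fs [] = _ , refl , []
      pull-walk {suc a} {b} le fs (e ∷ es)
        with le′ ← subst (_≤ suc D) (sym (+-suc a b)) le
        with z , refl ← covered (walk-mono (m+n≤o⇒n≤o a le′) (walk-∷ʳ fs e))
        with y , eq , es′ ← pull-walk le′ (walk-∷ʳ fs e) es = y , eq , pull e ∷ es′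

      push-star : ∀ {j x} → Star (Sameᴴ j) w x → Star (Sameᴳ j) v (embed x)
      push-star {j} {x} π = subst (λ v → Star (Sameᴳ j) v (embed x)) centre (Star.gmap embed push-same π)

      push-walk-centre : ∀ {x} → Walk _~ᴴ_ r w x → Walk _~ᴳ_ r v (embed x)
      push-walk-centre {r} {x} es = subst (λ v → Walk _~ᴳ_ r v (embed x)) centre (push-walk es)

      -- A monochromatic walk has no length bound, but `near` places each vertex reached so far
      -- within D of the centre, so the next one is within D + 1 and still visible. This fixes the
      -- horizon `suc D`.
      pull-star : ∀ {j x u} → (∀ x → Star (Sameᴴ j) w x → Walk _~ᴴ_ D w x) →
                  Star (Sameᴴ j) w x → Star (Sameᴳ j) (embed x) u →
                  ∃[ y ] embed y ≡ u × Star (Sameᴴ j) w y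
      pull-star near π ε = _ , refl , π
      pull-star {x = x} near π (e ◅ es)
        with z , refl ← covered (walk-∷ʳ (push-walk-centre (near x π)) (e .proj₁))
        = pull-star near (π ◅◅ pull-same e ◅ ε) es

      pull-from-centre : ∀ {j u} → (∀ x → Star (Sameᴴ j) w x → Walk _~ᴴ_ D w x) →
                         Star (Sameᴳ j) v u → ∃[ y ] embed y ≡ u × Star (Sameᴴ j) w y
      pull-from-centre {j} {u} near π =
        pull-star near ε (subst (λ v → Star (Sameᴳ j) v u) (sym centre) π)

    accepts-ball⁺ : Accepts (graph G) P v → Accepts (graph H) Q w
    accepts-ball⁺ acc = record
      { few-cuts = λ y e → subst₂ (λ f g → k * sum (λ j → δ (f j) (g j)) ≤ s * N)
          (trans (cong (decode ∘ P) (sym centre)) (sym (decode≡ w))) (sym (decode≡ y))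
          (few-cuts (embed y) (subst (_~ᴳ embed y) centre (push e)))
      ; near     = λ j x π →
          let y , eq , es = pull-walk (≤-trans (≤-reflexive (+-identityʳ D)) (n≤1+n D)) (push-walk-centre [])
                              (subst (λ v → Walk _~ᴳ_ D v (embed x)) (sym centre)
                                (near j (embed x) (push-star π)))
          in subst (Walk _~ᴴ_ D w) (embed-injective eq) es
      ; pieces   = λ j K piece → let open PieceAt piece renaming (embed to f) in pieces j K record
          { embed     = embed ∘ f
          ; component = λ x → push-star (component x)
          ; edge      = push ∘ edge
          ; injective = λ e e′ eq → injective e e′ (embed-injective eq)
          }
      }
      where open Accepts acc

    accepts-ball⁻ : Accepts (graph H) Q w → Accepts (graph G) P v
    accepts-ball⁻ acc = record
      { few-cuts = cuts
      ; near     = λ { j u π → let y , eq , π′ = pull-from-centre (near j) π in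
          subst (Walk _~ᴳ_ D v) eq (push-walk-centre (near j y π′)) }
      ; pieces   = λ j K piece →
          let open PieceAt piece renaming (embed to f)
              pulled = λ x → pull-from-centre (near j) (component x)
          in pieces j K record
          { embed     = proj₁ ∘ pulled
          ; component = λ x → pulled x .proj₂ .proj₂
          ; edge      = λ {x} {y} e → pull (subst₂ _~ᴳ_ (sym (pulled x .proj₂ .proj₁))
                                                       (sym (pulled y .proj₂ .proj₁)) (edge e))
          ; injective = λ {x} {_} {y} e e′ eq → injective e e′ (trans (sym (pulled x .proj₂ .proj₁))
                          (trans (cong embed eq) (pulled y .proj₂ .proj₁)))
          }
      }
      where
      open Accepts acc
      cuts : ∀ u → v ~ᴳ u → k * sum (λ j → δ (decode (P v) j) (decode (P u) j)) ≤ s * N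
      cuts u e with y , refl ← covered (walk-mono (s≤s z≤n) (e ∷ [])) =
        subst₂ (λ f g → k * sum (λ j → δ (f j) (g j)) ≤ s * N) (trans (decode≡ w) (cong (decode ∘ P) centre)) (decode≡ y)
          (few-cuts y (pull (subst (_~ᴳ embed y) (sym centre) e)))

  module _ (em : ExcludedMiddle 0ℓ) where

    verify : Verifier
    verify G P v = does (em {Accepts (graph G) P v})

    verify-local : Local (suc D) verify
    verify-local G P v H Q w ball =
      does-⇔ (mk⇔ (accepts-ball⁺ ball) (accepts-ball⁻ ball)) em em

    verify-true : ∀ (G : LabelledGraph n) P v → Accepts (graph G) P v → verify G P v ≡ true
    verify-true G P v = dec-true em

    verify-false : ∀ (G : LabelledGraph n) P v → ¬ Accepts (graph G) P v → verify G P v ≡ false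
    verify-false G P v = dec-false em

-- Counting modifications

∃-≤-average : ∀ m .{{_ : NonZero m}} {b} (f : Fin m → ℕ) → sum f ≤ m * b → ∃[ i ] f i ≤ b
∃-≤-average m {b} f sum≤ with Fin.any? (λ i → f i ≤? b)
... | yes ∃i = ∃i
... | no ¬∃ = contradiction (begin-strict
  m * b               <⟨ *-monoʳ-< m (n<1+n b) ⟩
  m * suc b           ≡⟨ sum-const m (suc b) ⟨
  sum {m} (λ _ → suc b) ≤⟨ sum-mono {m} _ f (λ i → ≰⇒> (λ le → ¬∃ (i , le))) ⟩
  sum f               ≤⟨ sum≤ ⟩
  m * b               ∎) (<-irrefl refl)
  where open ≤-Reasoning

ι : Bool → ℕ
ι b = if b then 1 else 0

length-filterᵇ-∷ : ∀ {A : Set} (p : A → Bool) x xs →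
                   length (filterᵇ p (x ∷ xs)) ≡ ι (p x) + length (filterᵇ p xs)
length-filterᵇ-∷ p x xs with p x
... | true  = refl
... | false = refl

-- Exchanging the sums over choices and over pairs turns a bound for each pair into one for the
-- totals.
double-count : ∀ {A : Set} k b (p : Fin m → A → Bool) (q : A → Bool) →
               (∀ x → k * sum (λ j → ι (p j x)) ≤ b * ι (q x)) →
               ∀ xs → k * sum (λ j → length (filterᵇ (p j) xs)) ≤ b * length (filterᵇ q xs)
double-count {m} k b p q p≤q [] = ≤-trans
  (≤-reflexive (trans (cong (k *_) (trans (sum-const m 0) (*-zeroʳ m))) (*-zeroʳ k))) z≤n
double-count {m} k b p q p≤q (x ∷ xs) = begin
  k * sum (λ j → length (filterᵇ (p j) (x ∷ xs)))
    ≡⟨ cong (k *_) (trans (sum-cong-≗ {m} (λ j → length-filterᵇ-∷ (p j) x xs))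
                          (∑-distrib-+ (λ j → ι (p j x)) (λ j → length (filterᵇ (p j) xs)))) ⟩
  k * (sum (λ j → ι (p j x)) + sum (λ j → length (filterᵇ (p j) xs)))
    ≡⟨ *-distribˡ-+ k (sum (λ j → ι (p j x))) _ ⟩
  k * sum (λ j → ι (p j x)) + k * sum (λ j → length (filterᵇ (p j) xs))
    ≤⟨ +-mono-≤ (p≤q x) (double-count k b p q p≤q xs) ⟩
  b * ι (q x) + b * length (filterᵇ q xs)
    ≡⟨ *-distribˡ-+ b (ι (q x)) _ ⟨
  b * (ι (q x) + length (filterᵇ q xs))
    ≡⟨ cong (b *_) (length-filterᵇ-∷ q x xs) ⟨
  b * length (filterᵇ q (x ∷ xs)) ∎
  where open ≤-Reasoning

#edges≡0⇒edgeless : (G : Graph n) → #edges G ≡ 0 → ∀ {u v} → ¬ Graph._~_ G u v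
#edges≡0⇒edgeless {n} G none {u} {v} e = case Fin.<-cmp u v of λ where
    (tri< u<v _ _)  → counted u<v e
    (tri≈ _ refl _) → subst T (Graph.adj-irrefl G u) e
    (tri> _ _ v<u)  → counted v<u (~-sym G e)
  where
  counted : ∀ {u v} → toℕ u < toℕ v → ¬ Graph._~_ G u v
  counted {u} {v} u<v e = contradiction (subst (0 <_) none (∈-length
    (∈-filter⁺ (λ _ → T? _) (∈-cartesianProduct⁺ (∈-allFin u) (∈-allFin v))
               (Equivalence.from T-∧ (<⇒<ᵇ u<v , e))))) λ ()

-- A rational lower bound q > 0 of ε is at least the reciprocal of its denominator.
≤-denominator-* : ∀ q → 0ℚ ℚ.< q → ∀ m n → q ℚ.* ℕ⇒ℚ m ℚ.≤ ℕ⇒ℚ n → m ≤ ↧ₙ q * n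
≤-denominator-* q@(mkℚ +[1+ a ] d-1 _) _ m n qm≤n = begin
  m                         ≤⟨ m≤n*m m (suc a) ⟩
  suc a * m                 ≡⟨ *-identityʳ (suc a * m) ⟨
  suc a * m * 1             ≤⟨ ℤ.drop‿+≤+ (subst₂ ℤ._≤_
                                 (trans (cong (ℤ._* ℤ.+ 1) (sym (ℤ.pos-* (suc a) m))) (sym (ℤ.pos-* (suc a * m) 1)))
                                 (sym (ℤ.pos-* n (suc d-1 * 1))) (ℚᵘ.drop-*≤* cross)) ⟩
  n * (suc d-1 * 1)         ≡⟨ cong (n *_) (*-identityʳ (suc d-1)) ⟩
  n * suc d-1               ≡⟨ *-comm n (suc d-1) ⟩
  suc d-1 * n               ∎
  where
  open ≤-Reasoning
  cross : toℚᵘ q ℚᵘ.* mkℚᵘ (ℤ.+ m) 0 ℚᵘ.≤ mkℚᵘ (ℤ.+ n) 0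
  cross = ℚᵘ.≤-respʳ-≃ (ℚ.toℚᵘ-fromℚᵘ (mkℚᵘ (ℤ.+ n) 0)) (ℚᵘ.≤-respˡ-≃
    (ℚᵘ.≃-trans (ℚ.toℚᵘ-homo-* q (ℕ⇒ℚ m)) (ℚᵘ.*-congˡ {toℚᵘ q} (ℚ.toℚᵘ-fromℚᵘ (mkℚᵘ (ℤ.+ m) 0))))
    (ℚ.toℚᵘ-mono-≤ qm≤n))
≤-denominator-* (mkℚ (ℤ.+ 0) _ _) (ℚ.*<* (ℤ.+<+ ())) m n _
≤-denominator-* (mkℚ (-[1+ _ ]) _ _) (ℚ.*<* ()) m n _

-- Completeness and soundness

module _ {G : Graph m} {H : Graph n} where

  ⊎ᴳ-edgeˡ : ∀ {x y} → Graph._~_ G x y → Graph._~_ (G ⊎ᴳ H) (x ↑ˡ n) (y ↑ˡ n)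
  ⊎ᴳ-edgeˡ {x} {y} e rewrite splitAt-↑ˡ m x n | splitAt-↑ˡ m y n = e

  ⊎ᴳ-edgeʳ : ∀ {x y} → Graph._~_ H x y → Graph._~_ (G ⊎ᴳ H) (m ↑ʳ x) (m ↑ʳ y)
  ⊎ᴳ-edgeʳ {x} {y} e rewrite splitAt-↑ʳ m n x | splitAt-↑ʳ m n y = e

↑ˡ≢↑ʳ : ∀ (i : Fin m) (j : Fin n) → i ↑ˡ n ≢ m ↑ʳ j
↑ˡ≢↑ʳ {m} {n} i j eq with trans (sym (splitAt-↑ˡ m i n)) (trans (cong (splitAt m) eq) (splitAt-↑ʳ m n j))
... | ()

edgeless : ∀ n → Graph n
edgeless n = record { adj = λ _ _ → false ; adj-sym = λ _ _ → refl ; adj-irrefl = λ _ → refl }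

module Sums (𝒫 : GraphClass) (monotone : Monotone 𝒫) (summable : Summable 𝒫) where

  -- When no edge of `H` joins `P` to its complement, `H` is a subgraph of the disjoint union of
  -- `G₁` and `G₂`; each map needs to be injective only on its own side.
  split-∈ : {G₁ : Graph m} {G₂ : Graph n} {H : Graph l}
            {P : Pred (Fin l) 0ℓ} (P? : ∀ x → Dec (P x)) (f : Fin l → Fin m) (g : Fin l → Fin n) →
            (∀ {x y} → P x → P y → f x ≡ f y → x ≡ y) →
            (∀ {x y} → ¬ P x → ¬ P y → g x ≡ g y → x ≡ y) →
            (∀ {x y} → Graph._~_ H x y →
              (P x × P y × Graph._~_ G₁ (f x) (f y)) ⊎ (¬ P x × ¬ P y × Graph._~_ G₂ (g x) (g y))) →
            𝒫 G₁ → 𝒫 G₂ → 𝒫 H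
  split-∈ {m} {n} {l} {G₁} {G₂} {H} {P} P? f g f-inj g-inj edge G₁∈ G₂∈ =
    monotone (h , (λ {x} {y} → h-injective x y) , h-edge) (summable G₁∈ G₂∈)
    where
    place : ∀ x → Dec (P x) → Fin (m + n)
    place x (yes _) = f x ↑ˡ n
    place x (no  _) = m ↑ʳ g x

    h : Fin l → Fin (m + n)
    h x = place x (P? x)

    h-injective : ∀ x y → h x ≡ h y → x ≡ y
    h-injective x y eq with P? x | P? y
    ... | yes Px | yes Py = f-inj Px Py (↑ˡ-injective n _ _ eq)
    ... | no ¬Px | no ¬Py = g-inj ¬Px ¬Py (↑ʳ-injective m _ _ eq)
    ... | yes _  | no _   = contradiction eq (↑ˡ≢↑ʳ _ _)
    ... | no _   | yes _  = contradiction (sym eq) (↑ˡ≢↑ʳ _ _)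

    h-edge : ∀ {x y} → Graph._~_ H x y → Graph._~_ (G₁ ⊎ᴳ G₂) (h x) (h y)
    h-edge {x} {y} e with P? x | P? y | edge e
    ... | yes _  | yes _  | inj₁ (_ , _ , e₁)    = ⊎ᴳ-edgeˡ {G = G₁} {H = G₂} e₁
    ... | no _   | no _   | inj₂ (_ , _ , e₂)    = ⊎ᴳ-edgeʳ {G = G₁} {H = G₂} e₂
    ... | no ¬Px | _      | inj₁ (Px , _ , _)    = contradiction Px ¬Px
    ... | _      | no ¬Py | inj₁ (_ , Py , _)    = contradiction Py ¬Py
    ... | yes Px | _      | inj₂ (¬Px , _ , _)   = contradiction Px ¬Px
    ... | _      | yes Py | inj₂ (_ , ¬Py , _)   = contradiction Py ¬Py

  -- Each further disjoint copy of `G` contributes one vertex, its copy of v, to an independent set.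
  edgeless-∈ : {G : Graph n} → Fin n → 𝒫 G → ∀ m → 𝒫 (edgeless m)
  edgeless-∈ v G∈ zero    = monotone ((λ ()) , (λ { {()} }) , λ { {()} }) G∈
  edgeless-∈ {n} {G} v G∈ (suc m) =
    monotone (h , (λ {x} {y} → h-injective x y) , λ { {_} {_} () }) (summable (edgeless-∈ v G∈ m) G∈)
    where
    h : Fin (suc m) → Fin (m + n)
    h zero    = m ↑ʳ v
    h (suc x) = x ↑ˡ n

    h-injective : ∀ x y → h x ≡ h y → x ≡ y
    h-injective zero    zero    _  = refl
    h-injective zero    (suc y) eq = contradiction (sym eq) (↑ˡ≢↑ʳ y v)
    h-injective (suc x) zero    eq = contradiction eq (↑ˡ≢↑ʳ x v)
    h-injective (suc x) (suc y) eq = cong suc (↑ˡ-injective n x y eq)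

¬∀⇒∃¬ : ExcludedMiddle 0ℓ → {A : Set} (P : Pred A 0ℓ) → ¬ (∀ x → P x) → ∃[ x ] ¬ P x
¬∀⇒∃¬ em P ¬∀ = decidable-stable em λ ¬∃ → ¬∀ λ x → decidable-stable em λ ¬Px → ¬∃ (x , ¬Px)

T-does⁻ : {A : Set} (a? : Dec A) → T (does a?) → A
T-does⁻ (yes a) _ = a

T-does⁺ : {A : Set} (a? : Dec A) → A → T (does a?)
T-does⁺ (yes _) _ = tt
T-does⁺ (no ¬a) a = contradiction a ¬a

-- The hypotheses give (d * s + 1) * M ≤ s * E ≤ d * s * M, so M vanishes, and then so does E. Here
-- E counts the edges and M the modifications.
≡0-by-ratio : ∀ {E M} d s → E ≤ d * M → suc (d * s) * M ≤ s * E → E ≡ 0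
≡0-by-ratio {E} {M} d s E≤dM kM≤sE = n≤0⇒n≡0 (≤-trans E≤dM (≤-reflexive (trans (cong (d *_) M≡0) (*-zeroʳ d))))
  where
  open ≤-Reasoning
  rearrange : ∀ s d M → s * (d * M) ≡ d * s * M
  rearrange = solve-∀
  M≡0 : M ≡ 0
  M≡0 = n≤0⇒n≡0 (+-cancelʳ-≤ (d * s * M) M 0 (begin
    M + d * s * M   ≤⟨ kM≤sE ⟩
    s * E           ≤⟨ *-monoʳ-≤ s E≤dM ⟩
    s * (d * M)     ≡⟨ rearrange s d M ⟩
    d * s * M       ∎))

module Scheme (em : ExcludedMiddle 0ℓ) (𝒫 : GraphClass) (monotone : Monotone 𝒫)
              (summable : Summable 𝒫) (N C s k D : ℕ) .{{_ : NonZero C}} where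
  open Sums 𝒫 monotone summable
  open Certificates N C
  open Verification N C s k D 𝒫

  -- The non-isolated vertices of `H` embed into `G`, and the isolated ones go to an edgeless graph.
  piece-∈ : ∀ {G : Graph n} {P j v} {H : Graph m} → 𝒫 G → PieceAt G P j v H → 𝒫 H
  piece-∈ {n} {m} {G} {P} {j} {v} {H} G∈ piece = split-∈ (λ x → em {∃[ y ] Graph._~_ H x y}) embed id
    (λ (_ , e) (_ , e′) → injective e e′) (λ _ _ → id)
    (λ {x} {y} e → inj₁ ((y , e) , (x , ~-sym H e) , edge e))
    G∈ (edgeless-∈ v G∈ m)
    where open PieceAt piece

  module Gluing {n} (G : Graph n) (P : Proof n) (accepts : ∀ v → Accepts G P v) (j : Fin N) where

    Same-sym : Symmetric (Same G P j)
    Same-sym (e , c) = ~-sym G e , sym c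

    uncut : Graph n
    uncut = record
      { adj        = λ u v → adj G u v ∧ does (decode (P u) j Fin.≟ decode (P v) j)
      ; adj-sym    = λ u v → cong₂ _∧_ (Graph.adj-sym G u v)
                       (does-⇔ (mk⇔ sym sym) (decode (P u) j Fin.≟ decode (P v) j) (decode (P v) j Fin.≟ decode (P u) j))
      ; adj-irrefl = λ u → cong (_∧ _) (Graph.adj-irrefl G u)
      }

    uncut⇒same : ∀ {u v} → Graph._~_ uncut u v → Same G P j u v
    uncut⇒same {u} {v} = map₂ (T-does⁻ (decode (P u) j Fin.≟ decode (P v) j)) ∘ Equivalence.to T-∧

    private
      component : Fin n → Fin n
      component = representative em {E = Same G P j} Same-sym

      component-adj : ∀ {u v} → Same G P j u v → component u ≡ component v
      component-adj e = representative-cong em {E = Same G P j} Same-sym (e ◅ ε)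

      -- `Q` selects components through their representatives while the vertex set remains `Fin n`,
      -- so components can be added one at a time.
      Restricted : Pred (Fin n) 0ℓ → Rel (Fin n) 0ℓ
      Restricted Q u v = Same G P j u v × Q (component u)

      restricted-sym : ∀ Q → Symmetric (Restricted Q)
      restricted-sym Q (e , q) = Same-sym e , subst Q (component-adj e) q

      restricted : Pred (Fin n) 0ℓ → Graph n
      restricted Q = record
        { adj        = λ u v → does (em {Restricted Q u v})
        ; adj-sym    = λ u v → does-⇔ (mk⇔ (restricted-sym Q) (restricted-sym Q)) (em {Restricted Q u v}) em
        ; adj-irrefl = λ u → dec-false em λ ((e , _) , _) → subst T (Graph.adj-irrefl G u) e
        }

      restricted⁻ : ∀ Q {u v} → Graph._~_ (restricted Q) u v → Restricted Q u v
      restricted⁻ Q = T-does⁻ em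

      restricted⁺ : ∀ Q {u v} → Restricted Q u v → Graph._~_ (restricted Q) u v
      restricted⁺ Q = T-does⁺ em

      component-∈ : ∀ x → 𝒫 (restricted (_≡ x))
      component-∈ x = Accepts.pieces (accepts x) j (restricted (_≡ x)) record
        { embed     = λ u → place u (component u Fin.≟ x)
        ; component = λ u → connected u (component u Fin.≟ x)
        ; edge      = λ {u} {v} e → let e″@(e′ , u∈) = restricted⁻ (_≡ x) e ; v∈ = restricted-sym (_≡ x) e″ .proj₂ in
                        subst₂ (Graph._~_ G) (sym (place-yes u∈)) (sym (place-yes v∈)) (e′ .proj₁)
        ; injective = λ {u} {_} {v} e e′ eq → trans (sym (place-yes (restricted⁻ (_≡ x) e .proj₂)))
                        (trans eq (place-yes (restricted⁻ (_≡ x) e′ .proj₂)))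
        }
        where
        -- Vertices outside the component are isolated in `restricted (_≡ x)`; they are sent to x as
        -- a default value that lies in the component of x.
        place : ∀ u → Dec (component u ≡ x) → Fin n
        place u (yes _) = u
        place u (no  _) = x

        place-yes : ∀ {u} → component u ≡ x → place u (component u Fin.≟ x) ≡ u
        place-yes {u} u∈ with component u Fin.≟ x
        ... | yes _ = refl
        ... | no u∉ = contradiction u∈ u∉

        connected : ∀ u u∈? → Star (Same G P j) x (place u u∈?)
        connected u (yes refl) = Star.reverse Same-sym (representative-reachable em {E = Same G P j} Same-sym u)
        connected u (no _)     = ε

      -- Each edge lies either in the component represented by x or in a later one, so `split-∈`
      -- adjoins one component at a time. The induction starts from an edgeless graph, which is a
      -- piece at the accepting vertex v.
      components-∈ : Fin n → ∀ xs → 𝒫 (restricted (_∈ xs))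
      components-∈ v [] = Accepts.pieces (accepts v) j (restricted (_∈ [])) record
        { embed     = λ _ → v
        ; component = λ _ → ε
        ; edge      = λ {x} {y} e → contradiction (restricted⁻ (_∈ []) e .proj₂) λ ()
        ; injective = λ {x} {x′} e → contradiction (restricted⁻ (_∈ []) e .proj₂) λ ()
        }
      components-∈ v (x ∷ xs) = split-∈ (λ u → component u Fin.≟ x) id id (λ _ _ → id) (λ _ _ → id)
        (λ {u} {w} e → edge (restricted⁻ (_∈ x ∷ xs) e) (component u Fin.≟ x)) (component-∈ x) (components-∈ v xs)
        where
        edge : ∀ {u w} → Restricted (_∈ x ∷ xs) u w → Dec (component u ≡ x) → _
        edge (e , _)         (yes u∈) =
          inj₁ (u∈ , trans (sym (component-adj e)) u∈ , restricted⁺ (_≡ x) (e , u∈))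
        edge (e , here u∈)   (no u∉)  = contradiction u∈ u∉
        edge (e , there u∈)  (no u∉)  =
          inj₂ (u∉ , u∉ ∘ trans (component-adj e) , restricted⁺ (_∈ xs) (e , u∈))

    uncut-∈ : Fin n → 𝒫 uncut
    uncut-∈ v = monotone (id , id , λ {x} {y} e → restricted⁺ (_∈ allFin n) (uncut⇒same e , ∈-allFin (component x)))
                         (components-∈ v (allFin n))

  module _ {n} (G : Graph n) (P : Proof n) (accepts : ∀ v → Accepts G P v) where
    open Gluing G P accepts

    modifications-total : k * sum (λ j → #modifications G (uncut j)) ≤ s * N * #edges G
    modifications-total = double-count k (s * N)
      (λ j (u , v) → (toℕ u <ᵇ toℕ v) ∧ (adj G u v xor adj (uncut j) u v))
      (λ (u , v) → (toℕ u <ᵇ toℕ v) ∧ adj G u v)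
      pointwise (cartesianProduct (allFin n) (allFin n))
      where
      pointwise : ∀ ((u , v) : Fin n × Fin n) →
        k * sum (λ j → ι ((toℕ u <ᵇ toℕ v) ∧ (adj G u v xor adj (uncut j) u v))) ≤
        s * N * ι ((toℕ u <ᵇ toℕ v) ∧ adj G u v)
      pointwise (u , v) with toℕ u <ᵇ toℕ v
      ... | false = ≤-trans (≤-reflexive (trans (cong (k *_) (trans (sum-const N 0) (*-zeroʳ N))) (*-zeroʳ k))) z≤n
      ... | true with adj G u v in e
      ...   | false = ≤-trans (≤-reflexive (trans (cong (k *_) (trans (sum-const N 0) (*-zeroʳ N))) (*-zeroʳ k))) z≤n
      -- On an edge, `uncut j` differs from `G` exactly when j cuts it, so `few-cuts` at u applies.
      ...   | true = ≤-trans (≤-reflexive (cong (k *_) (sum-cong-≗ {N} λ j → cut (does (decode (P u) j Fin.≟ decode (P v) j)))))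
        (≤-trans (Accepts.few-cuts (accepts u) v (subst T (sym e) tt)) (≤-reflexive (sym (*-identityʳ (s * N)))))
        where
        cut : ∀ b → ι (not b) ≡ (if b then 0 else 1)
        cut true  = refl
        cut false = refl

    few-modifications : .{{NonZero N}} → ∃[ j ] k * #modifications G (uncut j) ≤ s * #edges G
    few-modifications = ∃-≤-average N (λ j → k * #modifications G (uncut j)) (begin
      sum (λ j → k * #modifications G (uncut j)) ≡⟨ *-distribˡ-sum k (λ j → #modifications G (uncut j)) ⟨
      k * sum (λ j → #modifications G (uncut j)) ≤⟨ modifications-total ⟩
      s * N * #edges G                           ≡⟨ rearrange s N (#edges G) ⟩
      N * (s * #edges G)                         ∎)
      where
      open ≤-Reasoning
      rearrange : ∀ s N E → s * N * E ≡ N * (s * E)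
      rearrange = solve-∀

    -- Farness and few modifications together leave `G` without edges. Then `G` is a subgraph of
    -- `uncut i` and so belongs to `𝒫`, against the first half of `Far`.
    ¬far : .{{NonZero N}} → Fin n → ∀ d → k ≡ suc (d * s) →
           ∀ x → (∀ m n → x · m ≤ᵣ n → m ≤ d * n) → ¬ Far x 𝒫 G
    ¬far v d refl x d-bound (G∉ , far) = G∉ (monotone {H = G} {G = uncut i}
      (id , id , λ e → contradiction e (#edges≡0⇒edgeless G none)) (uncut-∈ i v))
      where
      i : Fin N
      i = few-modifications .proj₁

      none : #edges G ≡ 0
      none = ≡0-by-ratio d s
        (d-bound (#edges G) (#modifications G (uncut i)) (far (uncut i) (uncut-∈ i v)))
        (few-modifications .proj₂)

  verify-sound : .{{NonZero N}} → ∀ d → k ≡ suc (d * s) → (G : LabelledGraph n) → Fin n →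
                 ∀ x → (∀ m n → x · m ≤ᵣ n → m ≤ d * n) → Far x 𝒫 (graph G) →
                 ∀ (P : Proof n) → ∃[ v ] verify em G P v ≡ false
  verify-sound d k≡ G v x d-bound far P =
    let w , rejected = ¬∀⇒∃¬ em (Accepts (graph G) P)
                         λ accepts → ¬far (graph G) P accepts v d k≡ x d-bound far
    in w , verify-false em G P w rejected

  module _ .{{_ : NonZero N}} (colouring : ∀ {n} → Graph n → Fin n → Fin N → Fin C)
           (few-cuts : ∀ {n} (G : Graph n) → 𝒫 G → ∀ {u v} → Graph._~_ G u v →
             k * sum (λ j → δ (colouring G u j) (colouring G v j)) ≤ s * N)
           (near : ∀ {n} (G : Graph n) → 𝒫 G → ∀ j {u v} →
             Star (λ x y → Graph._~_ G x y × colouring G x j ≡ colouring G y j) u v →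
             Walk (Graph._~_ G) D u v) where

    certificate : Graph n → Proof n
    certificate G v = encode (colouring G v)

    decode-certificate : ∀ (G : Graph n) v j → decode (certificate G v) j ≡ colouring G v j
    decode-certificate G v = decode-encode (colouring G v)

    certificate-accepted : ∀ (G : Graph n) → 𝒫 G → ∀ v → Accepts G (certificate G) v
    certificate-accepted G G∈ v = record
      { few-cuts = λ u e → subst (λ x → k * x ≤ s * N)
          (sym (sum-cong-≗ {N} λ j → cong₂ δ (decode-certificate G v j) (decode-certificate G u j)))
          (few-cuts G G∈ e)
      ; near     = λ j u → near G G∈ j ∘ Star.map (λ {x} {y} (e , same) →
          e , trans (sym (decode-certificate G x j)) (trans same (decode-certificate G y j)))
      ; pieces   = λ j H → piece-∈ G∈
      }

    scheme : ∀ d → k ≡ suc (d * s) → ∀ p x → (∀ m n → x · m ≤ᵣ n → m ≤ d * n) →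
             Σ[ S ∈ ApproxProofLabellingScheme p (suc D) x 𝒫 ]
               ApproxProofLabellingScheme.ComplexityAtMost S (C ^ N)
    scheme d k≡ p x d-bound = record
      { prover   = λ G _ _ → certificate (graph G)
      ; verifier = verify em
      ; local    = verify-local em
      ; complete = λ G _ G∈ v → verify-true em G _ v (certificate-accepted (graph G) G∈ v)
      ; sound    = λ G inst → verify-sound d k≡ G (IsInstance.connected inst .proj₁ .proj₁) x d-bound
      } , λ G _ _ → size-bound (C ^ N) (certificate (graph G)) λ v → encode-length (colouring (graph G) v)

-- Choice of the constants

excluded-graph : ExcludedMiddle 0ℓ → (𝒢 : GraphClass) → Proper 𝒢 → ∃[ s ] Σ[ H ∈ Graph s ] ¬ 𝒢 H
excluded-graph em 𝒢 proper =
  let (s , H) , H∉ = ¬∀⇒∃¬ em {Σ ℕ Graph} (λ (_ , G) → 𝒢 G) λ all → proper λ G → all (_ , G)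
  in s , H , H∉

-- Roundedness of the lower cut yields a rational q with 0 < q < ε, and its denominator serves as d.
reciprocal : (ε : ℝ) → Positive ε → ∃[ d ] (∀ m n → ε · m ≤ᵣ n → m ≤ d * n)
reciprocal x x>0 with q , 0<q , q<x ← Equivalence.to (ℝ.lower-rounded x 0ℚ) x>0 =
  ↧ₙ q , λ m n x·m≤n → ≤-denominator-* q 0<q m n (x·m≤n q q<x)

theorem4 : ExcludedMiddle 0ℓ →
    (p : Polynomial) (ε : ℝ) → Positive ε →
    (𝒢 : GraphClass) → MinorClosed 𝒢 → Proper 𝒢 →
    (𝒫 : GraphClass) → IsPropertyOf 𝒫 𝒢 → Monotone 𝒫 → Summable 𝒫 →
    ∃[ r ] ∃[ K ] Σ[ S ∈ ApproxProofLabellingScheme p r ε 𝒫 ]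
    ApproxProofLabellingScheme.ComplexityAtMost S K
theorem4 em p x x>0 𝒢 minor-closed proper 𝒫 property monotone summable =
  let s , H₀ , H₀∉ = excluded-graph em 𝒢 proper
      d , d-bound  = reciprocal x x>0
  in suc (D s d) , (2 ^ s) ^ (k s d ^ s) , scheme s d H₀ H₀∉ d-bound
  where
  -- The value of `k` makes s / k < 1 / d, so the fraction of cut edges falls below 1 / d, which is
  -- less than ε. The value of `D` is the bound of `weak-diameter`.
  k D : ℕ → ℕ → ℕ
  k s d = suc (d * s)
  D s d = (2 + s) * suc (s * k s d + s * k s d)

  module _ (s d : ℕ) (H₀ : Graph s) (H₀∉ : ¬ 𝒢 H₀) (d-bound : ∀ m n → x · m ≤ᵣ n → m ≤ d * n) where
    instance
      N≢0 : NonZero (k s d ^ s)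
      N≢0 = m^n≢0 (k s d) s

      C≢0 : NonZero (2 ^ s)
      C≢0 = m^n≢0 2 s

    H₀-free : ∀ {n} {G : Graph n} → 𝒫 G → ¬ (H₀ ≼ G)
    H₀-free G∈ H₀≼G = H₀∉ (minor-closed H₀≼G (IsPropertyOf.included property G∈))

    colouring : ∀ {n} → Graph n → Fin n → Fin (k s d ^ s) → Fin (2 ^ s)
    colouring G v j = Decomposition.colour G (Minors.layers em G) (k s d) s 0 (λ _ → ⊤) j v

    scheme : Σ[ S ∈ ApproxProofLabellingScheme p (suc (D s d)) x 𝒫 ]
               ApproxProofLabellingScheme.ComplexityAtMost S ((2 ^ s) ^ (k s d ^ s))
    scheme = Scheme.scheme em 𝒫 (λ {m} {n} {H} {G} → monotone {m} {n} {H} {G}) summable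
      (k s d ^ s) (2 ^ s) s (k s d) (D s d) colouring
      (λ G _ e → Decomposition.cut-bound G (Minors.layers em G) (k s d) s (tt , tt , e))
      (λ G G∈ j → Minors.weak-diameter em G (k s d) s (H₀-free G∈) ∘
         Star.map (λ (e , same) → (tt , tt , e) , same))
      d refl p x d-bound
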